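{- Let $n$ be a positive integer and $p$ a prime number. If $n = p^k$, where $k$ is a positive integer, or if $n = 2^k p^\ell$, where $k, \ell$ are positive integers and $p$ is odd, then $$\operatorname{Cond}(V_n) = \varphi(n)\sqrt{2\left(1 - \frac{1}{p}\right)},$$ where $V_n$ is the Vandermonde matrix associated with the $n$th cyclotomic polynomial and $\varphi$ is Euler's totient function.
   Context: For a positive integer $n$, let $m := \varphi(n)$ (Euler's totient function) and let $\zeta_1, \dots, \zeta_m \in \mathbb{C}$ be the primitive $n$th roots of unity (listed in any fixed order). The Vandermonde matrix associated with the $n$th cyclotomic polynomial is the $m \times m$ complex matrix $V_n := (\zeta_i^{\,j-1})_{1 \leq i,j \leq m}$; it is invertible since the $\zeta_i$ are distinct. The condition number of an invertible complex $k \times k$ matrix $A = (a_{i,j})$ is $\operatorname{Cond}(A) := \|A\|\,\|A^{ -1}\|$, where $\|A\| := \sqrt{\sum_{i=1}^k \sum_{j=1}^k |a_{i,j}|^2} = \sqrt{\operatorname{Tr}(A^*A)}$ is the Frobenius norm and $A^*$ is the conjugate transpose of $A$. -}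

module Defs where

open import Algebra.Bundles.Raw using (RawSemiring)
import Algebra.Definitions.RawSemiring as RawSemiringDefs
open import Data.Bool.Base using (if_then_else_)
open import Data.Fin.Base using (Fin; toℕ)
open import Data.Fin.Properties using () renaming (_≟_ to _≟ᶠ_)
open import Data.Integer.Base as ℤ using (ℤ; +_; -[1+_]; +[1+_]) renaming (_*_ to _*ᶻ_)
import Data.Integer.DivMod as ℤ
import Data.Integer.Properties as ℤ
open import Data.List.Base using (applyUpTo; filter; length)
open import Data.Nat.Base as ℕ using (ℕ; zero; suc; z≤n; s≤s)
open import Data.Nat.Coprimality using (coprime?)
import Data.Nat.Properties as ℕ
open import Data.Product.Base using (Σ; ∃; _×_; _,_; proj₁; proj₂)
open import Data.Rational.Base as ℚ
  using (ℚ; mkℚ; 0ℚ; 1ℚ; ½; _+_; _*_; -_; _-_; _≤_; _<_; _⊔_; ∣_∣; _/_; 1/_; floor; toℚᵘ; *≤*; *<*)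
open import Data.Rational.Properties
open import Data.Rational.Solver using (module +-*-Solver)
open import Data.Rational.Unnormalised.Base as ℚᵘ using (mkℚᵘ)
import Data.Rational.Unnormalised.Properties as ℚᵘ
open import Data.Sum.Base using (inj₁; inj₂)
open import Data.Vec.Functional using (Vector)
open import Level using (0ℓ)
open import Relation.Binary.PropositionalEquality
  using (_≡_; refl; sym; trans; cong; cong₂; subst; subst₂)
open import Relation.Nullary using (¬_; Dec; does; yes; no; contradiction)

half+half : ∀ ε → ½ * ε + ½ * ε ≡ ε
half+half ε = trans (sym (*-distribʳ-+ ε ½ ½)) (*-identityˡ ε)

half-pos : ∀ {ε} → 0ℚ < ε → 0ℚ < ½ * ε
half-pos {ε} 0<ε = subst (_< ½ * ε) (*-zeroʳ ½) (*-monoʳ-<-pos ½ 0<ε)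

p≤∣p∣ : ∀ p → p ≤ ∣ p ∣
p≤∣p∣ p with ≤-total 0ℚ p
... | inj₁ 0≤p = ≤-reflexive (sym (0≤p⇒∣p∣≡p 0≤p))
... | inj₂ p≤0 = ≤-trans p≤0 (0≤∣p∣ p)

∣p-q∣≡∣q-p∣ : ∀ p q → ∣ p - q ∣ ≡ ∣ q - p ∣
∣p-q∣≡∣q-p∣ p q =
  trans (sym (∣-p∣≡∣p∣ (p - q)))
        (cong ∣_∣ (solve 2 (λ a b → :- (a :- b) := b :- a) refl p q))
  where open +-*-Solver

∣p-q∣<ε⇒p<q+ε : ∀ {p q ε} → ∣ p - q ∣ < ε → p < q + ε
∣p-q∣<ε⇒p<q+ε {p} {q} {ε} h =
  subst (_< q + ε) (solve 2 (λ a b → b :+ (a :- b) := a) refl p q)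
    (+-monoʳ-< q (≤-<-trans (p≤∣p∣ (p - q)) h))
  where open +-*-Solver

p<q+ε⇒∣p-q∣<ε : ∀ {p q ε} → p < q + ε → q < p + ε → ∣ p - q ∣ < ε
p<q+ε⇒∣p-q∣<ε {p} {q} {ε} h₁ h₂ with ∣p∣≡p∨∣p∣≡-p (p - q)
... | inj₁ eq = subst₂ _<_ (sym eq)
      (solve 2 (λ b e → (b :+ e) :- b := e) refl q ε) (+-monoˡ-< (- q) h₁)
  where open +-*-Solver
... | inj₂ eq = subst₂ _<_
      (trans (solve 2 (λ a b → b :- a := :- (a :- b)) refl p q) (sym eq))
      (solve 2 (λ a e → (a :+ e) :- a := e) refl p ε) (+-monoˡ-< (- p) h₂)
  where open +-*-Solver

square-mono : ∀ {a b} → 0ℚ ≤ a → a ≤ b → a * a ≤ b * b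
square-mono {a} {b} 0≤a a≤b = ≤-trans
  (*-monoˡ-≤-nonNeg a {{ℚ.nonNegative 0≤a}} a≤b)
  (*-monoʳ-≤-nonNeg b {{ℚ.nonNegative (≤-trans 0≤a a≤b)}} a≤b)

square-cancel-< : ∀ {a b} → 0ℚ ≤ b → a * a < b * b → a < b
square-cancel-< {a} {b} 0≤b h with a <? b
... | yes a<b = a<b
... | no  a≮b = contradiction (<-≤-trans h (square-mono 0≤b (≮⇒≥ a≮b))) (<-irrefl refl)

archimedean : ∀ ε → 0ℚ < ε → ∃ λ N → ∀ n → N ℕ.≤ n → + 1 / suc n ≤ ε
archimedean (mkℚ (+ zero)   d c) (*<* (ℤ.+<+ ()))
archimedean (mkℚ -[1+ a ]   d c) (*<* ())
archimedean (mkℚ +[1+ a ]   d c) _ = d , λ n d≤n → toℚᵘ-cancel-≤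
  (ℚᵘ.≤-respˡ-≃ (ℚᵘ.≃-sym (toℚᵘ-fromℚᵘ (mkℚᵘ (+ 1) n)))
    (ℚᵘ.*≤* (ℤ.+≤+ (ℕ.*-mono-≤ (s≤s (z≤n {a})) (s≤s d≤n)))))

record IsCauchy (x : ℕ → ℚ) : Set where
  constructor mkCauchy
  field
    modulus : ∀ ε → 0ℚ < ε → ∃ λ N → ∀ m n → N ℕ.≤ m → N ℕ.≤ n → ∣ x m - x n ∣ < ε
open IsCauchy public

record ℝ : Set where
  constructor mkℝ
  field
    seq    : ℕ → ℚ
    cauchy : IsCauchy seq
open ℝ public

infix 4 _≈ᴿ_

record _≈ᴿ_ (x y : ℝ) : Set where
  constructor mk≈ᴿ
  field
    close : ∀ ε → 0ℚ < ε → ∃ λ N → ∀ n → N ℕ.≤ n → ∣ seq x n - seq y n ∣ < ε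
open _≈ᴿ_ public

fromℚ : ℚ → ℝ
fromℚ q = mkℝ (λ _ → q) (mkCauchy λ ε 0<ε →
  0 , λ _ _ _ _ → subst (_< ε) (sym (cong ∣_∣ (+-inverseʳ q))) 0<ε)

fromℕ : ℕ → ℝ
fromℕ n = fromℚ (+ n / 1)

+-cauchy : ∀ {x y} → IsCauchy x → IsCauchy y → IsCauchy (λ n → x n + y n)
modulus (+-cauchy {x} {y} cx cy) ε 0<ε =
  let N₁ , h₁ = modulus cx (½ * ε) (half-pos 0<ε)
      N₂ , h₂ = modulus cy (½ * ε) (half-pos 0<ε)
  in N₁ ℕ.⊔ N₂ , λ m n N≤m N≤n → begin-strict
    ∣ (x m + y m) - (x n + y n) ∣
      ≡⟨ cong ∣_∣ (solve 4 (λ a b c d → (a :+ b) :- (c :+ d) := (a :- c) :+ (b :- d))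
                     refl (x m) (y m) (x n) (y n)) ⟩
    ∣ (x m - x n) + (y m - y n) ∣
      ≤⟨ ∣p+q∣≤∣p∣+∣q∣ (x m - x n) (y m - y n) ⟩
    ∣ x m - x n ∣ + ∣ y m - y n ∣
      <⟨ +-mono-< (h₁ m n (ℕ.m⊔n≤o⇒m≤o N₁ N₂ N≤m) (ℕ.m⊔n≤o⇒m≤o N₁ N₂ N≤n))
                  (h₂ m n (ℕ.m⊔n≤o⇒n≤o N₁ N₂ N≤m) (ℕ.m⊔n≤o⇒n≤o N₁ N₂ N≤n)) ⟩
    ½ * ε + ½ * ε
      ≡⟨ half+half ε ⟩
    ε ∎
  where open ≤-Reasoning; open +-*-Solver

-‿cauchy : ∀ {x} → IsCauchy x → IsCauchy (λ n → - x n)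
modulus (-‿cauchy {x} cx) ε 0<ε =
  let N , h = modulus cx ε 0<ε
  in N , λ m n N≤m N≤n → subst (_< ε)
    (trans (sym (∣-p∣≡∣p∣ (x m - x n)))
      (cong ∣_∣ (solve 2 (λ a b → :- (a :- b) := (:- a) :- (:- b)) refl (x m) (x n))))
    (h m n N≤m N≤n)
  where open +-*-Solver

eventually-bounded : ∀ {x} → IsCauchy x →
  ∃ λ B → 0ℚ < B × ∃ λ N → ∀ n → N ℕ.≤ n → ∣ x n ∣ ≤ B
eventually-bounded {x} cx =
  let N , h = modulus cx 1ℚ 0<1
  in ∣ x N ∣ + 1ℚ
   , <-≤-trans 0<1 (subst (_≤ ∣ x N ∣ + 1ℚ) (+-identityˡ 1ℚ) (+-monoˡ-≤ 1ℚ (0≤∣p∣ (x N))))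
   , N , λ n N≤n → begin
    ∣ x n ∣
      ≡⟨ cong ∣_∣ (solve 2 (λ a b → a := b :+ (a :- b)) refl (x n) (x N)) ⟩
    ∣ x N + (x n - x N) ∣
      ≤⟨ ∣p+q∣≤∣p∣+∣q∣ (x N) (x n - x N) ⟩
    ∣ x N ∣ + ∣ x n - x N ∣
      ≤⟨ +-monoʳ-≤ ∣ x N ∣ (<⇒≤ (h n N N≤n ℕ.≤-refl)) ⟩
    ∣ x N ∣ + 1ℚ ∎
  where
  open ≤-Reasoning
  open +-*-Solver
  0<1 : 0ℚ < 1ℚ
  0<1 = positive⁻¹ 1ℚ

*-small : ∀ {p q B ε} (0<B : 0ℚ < B) → ∣ p ∣ ≤ B →
          ∣ q ∣ < (1/ B) {{ℚ.>-nonZero 0<B}} * ε → ∣ p * q ∣ < ε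
*-small {p} {q} {B} {ε} 0<B p≤B q<ε/B = begin-strict
  ∣ p * q ∣             ≡⟨ ∣p*q∣≡∣p∣*∣q∣ p q ⟩
  ∣ p ∣ * ∣ q ∣         ≤⟨ *-monoʳ-≤-nonNeg ∣ q ∣ {{∣-∣-nonNeg q}} p≤B ⟩
  B * ∣ q ∣             <⟨ *-monoʳ-<-pos B {{B-pos}} q<ε/B ⟩
  B * (1/B * ε)         ≡⟨ *-assoc B 1/B ε ⟨
  (B * 1/B) * ε         ≡⟨ cong (_* ε) (*-inverseʳ B {{B≢0}}) ⟩
  1ℚ * ε                ≡⟨ *-identityˡ ε ⟩
  ε                     ∎
  where
  open ≤-Reasoning
  B≢0   = ℚ.>-nonZero 0<B
  B-pos = ℚ.positive 0<B
  1/B   = (1/ B) {{B≢0}}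

scaled-pos : ∀ {B ε} (0<B : 0ℚ < B) → 0ℚ < ε → 0ℚ < (1/ B) {{ℚ.>-nonZero 0<B}} * ε
scaled-pos {B} {ε} 0<B 0<ε =
  subst (_< 1/B * ε) (*-zeroʳ 1/B) (*-monoʳ-<-pos 1/B {{1/pos⇒pos B {{ℚ.positive 0<B}}}} 0<ε)
  where 1/B = (1/ B) {{ℚ.>-nonZero 0<B}}

*-cauchy : ∀ {x y} → IsCauchy x → IsCauchy y → IsCauchy (λ n → x n * y n)
modulus (*-cauchy {x} {y} cx cy) ε 0<ε =
  let A , 0<A , N₁ , x≤A = eventually-bounded cx
      B , 0<B , N₂ , y≤B = eventually-bounded cy
      N₃ , h₃ = modulus cx _ (scaled-pos 0<B (half-pos 0<ε))
      N₄ , h₄ = modulus cy _ (scaled-pos 0<A (half-pos 0<ε))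
      M₁ = N₁ ℕ.⊔ N₂
      M₂ = N₃ ℕ.⊔ N₄
      ≥N₁ = λ {k} (h : M₁ ℕ.⊔ M₂ ℕ.≤ k) → ℕ.m⊔n≤o⇒m≤o N₁ N₂ (ℕ.m⊔n≤o⇒m≤o M₁ M₂ h)
      ≥N₂ = λ {k} (h : M₁ ℕ.⊔ M₂ ℕ.≤ k) → ℕ.m⊔n≤o⇒n≤o N₁ N₂ (ℕ.m⊔n≤o⇒m≤o M₁ M₂ h)
      ≥N₃ = λ {k} (h : M₁ ℕ.⊔ M₂ ℕ.≤ k) → ℕ.m⊔n≤o⇒m≤o N₃ N₄ (ℕ.m⊔n≤o⇒n≤o M₁ M₂ h)
      ≥N₄ = λ {k} (h : M₁ ℕ.⊔ M₂ ℕ.≤ k) → ℕ.m⊔n≤o⇒n≤o N₃ N₄ (ℕ.m⊔n≤o⇒n≤o M₁ M₂ h)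
  in M₁ ℕ.⊔ M₂ , λ m n N≤m N≤n → begin-strict
    ∣ x m * y m - x n * y n ∣
      ≡⟨ cong ∣_∣ (solve 4 (λ a b c d → a :* b :- c :* d := a :* (b :- d) :+ d :* (a :- c))
                     refl (x m) (y m) (x n) (y n)) ⟩
    ∣ x m * (y m - y n) + y n * (x m - x n) ∣
      ≤⟨ ∣p+q∣≤∣p∣+∣q∣ (x m * (y m - y n)) (y n * (x m - x n)) ⟩
    ∣ x m * (y m - y n) ∣ + ∣ y n * (x m - x n) ∣
      <⟨ +-mono-< (*-small {x m} {y m - y n} 0<A (x≤A m (≥N₁ N≤m)) (h₄ m n (≥N₄ N≤m) (≥N₄ N≤n)))
                  (*-small {y n} {x m - x n} 0<B (y≤B n (≥N₂ N≤n)) (h₃ m n (≥N₃ N≤m) (≥N₃ N≤n))) ⟩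
    ½ * ε + ½ * ε
      ≡⟨ half+half ε ⟩
    ε ∎
  where open ≤-Reasoning; open +-*-Solver

infixl 6 _+ᴿ_ _-ᴿ_
infixl 7 _*ᴿ_
infix  8 -ᴿ_

_+ᴿ_ _*ᴿ_ : ℝ → ℝ → ℝ
x +ᴿ y = mkℝ (λ n → seq x n + seq y n) (+-cauchy (cauchy x) (cauchy y))
x *ᴿ y = mkℝ (λ n → seq x n * seq y n) (*-cauchy (cauchy x) (cauchy y))

-ᴿ_ : ℝ → ℝ
-ᴿ x = mkℝ (λ n → - seq x n) (-‿cauchy (cauchy x))

_-ᴿ_ : ℝ → ℝ → ℝ
x -ᴿ y = x +ᴿ (-ᴿ y)

ℝ-rawSemiring : RawSemiring 0ℓ 0ℓ
ℝ-rawSemiring = record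
  { Carrier = ℝ ; _≈_ = _≈ᴿ_ ; _+_ = _+ᴿ_ ; _*_ = _*ᴿ_ ; 0# = fromℚ 0ℚ ; 1# = fromℚ 1ℚ }

open RawSemiringDefs ℝ-rawSemiring public
  using () renaming (sum to sumᴿ; _^_ to _^ᴿ_)

isqrt-step : ∀ r n → Dec (suc r ℕ.* suc r ℕ.≤ n) → ℕ
isqrt-step r n (yes _) = suc r
isqrt-step r n (no  _) = r

isqrt : ℕ → ℕ
isqrt zero    = 0
isqrt (suc n) = next (isqrt n)
  where next = λ r → isqrt-step r (suc n) (suc r ℕ.* suc r ℕ.≤? suc n)

isqrt-step-bounds : ∀ r n d → r ℕ.* r ℕ.≤ n → n ℕ.< suc r ℕ.* suc r →
  let s = isqrt-step r (suc n) d in s ℕ.* s ℕ.≤ suc n × suc n ℕ.< suc s ℕ.* suc s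
isqrt-step-bounds r n (yes h) lo hi =
  h , ℕ.≤-<-trans hi (ℕ.*-mono-< (ℕ.n<1+n (suc r)) (ℕ.n<1+n (suc r)))
isqrt-step-bounds r n (no ¬h) lo hi = ℕ.m≤n⇒m≤1+n lo , ℕ.≰⇒> ¬h

isqrt-bounds : ∀ n → isqrt n ℕ.* isqrt n ℕ.≤ n × n ℕ.< suc (isqrt n) ℕ.* suc (isqrt n)
isqrt-bounds zero    = z≤n , s≤s z≤n
isqrt-bounds (suc n) =
  isqrt-step-bounds (isqrt n) n (suc (isqrt n) ℕ.* suc (isqrt n) ℕ.≤? suc n)
    (proj₁ (isqrt-bounds n)) (proj₂ (isqrt-bounds n))

-- The largest multiple of 1/(n+1) whose square is at most max(0, q).
sqrtApprox : ℕ → ℚ → ℚ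
sqrtApprox n q = + isqrt ℤ.∣ floor ((0ℚ ⊔ q) * (+ (suc n ℕ.* suc n) / 1)) ∣ / suc n

module _ where
  private
    ι : ℤ → ℚ
    ι i = i / 1

    toℚᵘ-/ : ∀ i n → toℚᵘ (i / suc n) ℚᵘ.≃ mkℚᵘ i n
    toℚᵘ-/ i n = toℚᵘ-fromℚᵘ (mkℚᵘ i n)

    ι-* : ∀ i j → ι (i *ᶻ j) ≡ ι i * ι j
    ι-* i j = toℚᵘ-injective (begin
      toℚᵘ (ι (i *ᶻ j))          ≈⟨ toℚᵘ-/ (i *ᶻ j) 0 ⟩
      mkℚᵘ i 0 ℚᵘ.* mkℚᵘ j 0     ≈⟨ ℚᵘ.*-cong (toℚᵘ-/ i 0) (toℚᵘ-/ j 0) ⟨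
      toℚᵘ (ι i) ℚᵘ.* toℚᵘ (ι j) ≈⟨ toℚᵘ-homo-* (ι i) (ι j) ⟨
      toℚᵘ (ι i * ι j)           ∎)
      where open ℚᵘ.≃-Reasoning

    ι-mono-≤ : ∀ {i j} → i ℤ.≤ j → ι i ≤ ι j
    ι-mono-≤ {i} {j} i≤j = toℚᵘ-cancel-≤
      (ℚᵘ.≤-respˡ-≃ (ℚᵘ.≃-sym (toℚᵘ-/ i 0)) (ℚᵘ.≤-respʳ-≃ (ℚᵘ.≃-sym (toℚᵘ-/ j 0))
        (ℚᵘ.*≤* (ℤ.*-monoʳ-≤-nonNeg (+ 1) i≤j))))

    /≡ι* : ∀ i n → i / suc n ≡ ι i * (+ 1 / suc n)
    /≡ι* i n = toℚᵘ-injective (begin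
      toℚᵘ (i / suc n)                     ≈⟨ toℚᵘ-/ i n ⟩
      mkℚᵘ i n                             ≈⟨ ℚᵘ.*≡* (cong₂ _*ᶻ_ (ℤ.*-identityʳ i) (cong +_ (sym (ℕ.+-identityʳ (suc n))))) ⟨
      mkℚᵘ i 0 ℚᵘ.* mkℚᵘ (+ 1) n           ≈⟨ ℚᵘ.*-cong (toℚᵘ-/ i 0) (toℚᵘ-/ (+ 1) n) ⟨
      toℚᵘ (ι i) ℚᵘ.* toℚᵘ (+ 1 / suc n)   ≈⟨ toℚᵘ-homo-* (ι i) (+ 1 / suc n) ⟨
      toℚᵘ (ι i * (+ 1 / suc n))           ∎)
      where open ℚᵘ.≃-Reasoning

    ι-inverse : ∀ n → ι (+ suc n) * (+ 1 / suc n) ≡ 1ℚ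
    ι-inverse n = trans (sym (/≡ι* (+ suc n) n)) (toℚᵘ-injective (begin
      toℚᵘ (+ suc n / suc n)  ≈⟨ toℚᵘ-/ (+ suc n) n ⟩
      mkℚᵘ (+ suc n) n        ≈⟨ ℚᵘ.*≡* (ℤ.*-comm (+ suc n) (+ 1)) ⟩
      toℚᵘ 1ℚ                 ∎))
      where open ℚᵘ.≃-Reasoning

    floor-lower : ∀ q → ι (floor q) ≤ q
    floor-lower q@(mkℚ a d _) = toℚᵘ-cancel-≤
      (ℚᵘ.≤-respˡ-≃ (ℚᵘ.≃-sym (toℚᵘ-/ (floor q) 0))
        (ℚᵘ.*≤* (subst (floor q *ᶻ + suc d ℤ.≤_) (sym (ℤ.*-identityʳ a)) (ℤ.[n/d]*d≤n a (+ suc d)))))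

    floor-upper : ∀ q → q < ι (ℤ.suc (floor q))
    floor-upper q@(mkℚ a d _) = toℚᵘ-cancel-<
      (ℚᵘ.<-respʳ-≃ (ℚᵘ.≃-sym (toℚᵘ-/ (ℤ.suc (floor q)) 0))
        (ℚᵘ.*<* (subst₂ ℤ._<_ (sym (ℤ.*-identityʳ a))
          (cong (λ f → ℤ.suc f *ᶻ + suc d) (sym (ℤ.div-pos-is-/ℕ a (suc d))))
          (ℤ.n<s[n/ℕd]*d a (suc d)))))

    floor-nonNeg : ∀ q → 0ℚ ≤ q → + ℤ.∣ floor q ∣ ≡ floor q
    floor-nonNeg q@(mkℚ a d _) (*≤* h) = ℤ.0≤i⇒+∣i∣≡i (ℤ.0≤n⇒0≤n/d a (+ suc d)
      (subst₂ ℤ._≤_ (ℤ.*-zeroˡ (+ suc d)) (ℤ.*-identityʳ a) h) (ℤ.+≤+ z≤n))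

  1/suc-pos : ∀ n → 0ℚ < + 1 / suc n
  1/suc-pos n = positive⁻¹ (+ 1 / suc n) {{normalize-pos 1 (suc n)}}

  0≤sqrtApprox : ∀ n q → 0ℚ ≤ sqrtApprox n q
  0≤sqrtApprox n q = nonNegative⁻¹ (sqrtApprox n q) 
    {{normalize-nonNeg (isqrt ℤ.∣ floor ((0ℚ ⊔ q) * (+ (suc n ℕ.* suc n) / 1)) ∣) (suc n)}}

  sqrtApprox-bounds : ∀ n q → let s = sqrtApprox n q ; u = + 1 / suc n in
    s * s ≤ 0ℚ ⊔ q × 0ℚ ⊔ q < (s + u) * (s + u)
  sqrtApprox-bounds n q = lower , upper
    where
    open ≤-Reasoning
    open +-*-Solver
    x = 0ℚ ⊔ q
    u = + 1 / suc n
    M = + (suc n ℕ.* suc n) / 1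
    y = x * M
    a = ℤ.∣ floor y ∣
    r = isqrt a
    s = sqrtApprox n q

    0≤u : 0ℚ ≤ u
    0≤u = <⇒≤ (1/suc-pos n)

    uu-pos : ℚ.Positive (u * u)
    uu-pos = pos*pos⇒pos u {{normalize-pos 1 (suc n)}} u {{normalize-pos 1 (suc n)}}

    0≤y : 0ℚ ≤ y
    0≤y = nonNegative⁻¹ y {{nonNeg*nonNeg⇒nonNeg x {{ℚ.nonNegative (p≤p⊔q 0ℚ q)}} M
            {{normalize-nonNeg (suc n ℕ.* suc n) 1}}}}

    a≡ : + a ≡ floor y
    a≡ = floor-nonNeg y 0≤y

    yuu≡x : y * (u * u) ≡ x
    yuu≡x = begin-equality
      x * M * (u * u)
        ≡⟨ cong (λ m → x * m * (u * u)) (trans (cong ι (ℤ.pos-* (suc n) (suc n))) (ι-* (+ suc n) (+ suc n))) ⟩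
      x * (ι (+ suc n) * ι (+ suc n)) * (u * u)
        ≡⟨ solve 3 (λ x m u → x :* (m :* m) :* (u :* u) := x :* ((m :* u) :* (m :* u))) refl x (ι (+ suc n)) u ⟩
      x * ((ι (+ suc n) * u) * (ι (+ suc n) * u))
        ≡⟨ cong (λ t → x * (t * t)) (ι-inverse n) ⟩
      x * (1ℚ * 1ℚ)
        ≡⟨ *-identityʳ x ⟩
      x ∎

    ι-square : ∀ k → ι (+ (k ℕ.* k)) * (u * u) ≡ (ι (+ k) * u) * (ι (+ k) * u)
    ι-square k = trans (cong (_* (u * u)) (trans (cong ι (ℤ.pos-* k k)) (ι-* (+ k) (+ k))))
      (solve 2 (λ a u → a :* a :* (u :* u) := (a :* u) :* (a :* u)) refl (ι (+ k)) u)

    s≡ : s ≡ ι (+ r) * u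
    s≡ = /≡ι* (+ r) n

    ι-suc : ι (+ suc r) * u ≡ s + u
    ι-suc = begin-equality
      ι (+ suc r) * u
        ≡⟨ cong (_* u) (toℚᵘ-injective (ℚᵘ.≃-trans (toℚᵘ-/ (+ suc r) 0) (ℚᵘ.≃-sym
             (ℚᵘ.≃-trans (toℚᵘ-homo-+ (ι (+ r)) 1ℚ) (ℚᵘ.≃-trans (ℚᵘ.+-congˡ ℚᵘ.1ℚᵘ (toℚᵘ-/ (+ r) 0))
             (ℚᵘ.*≡* (cong (_*ᶻ + 1) (trans (cong (ℤ._+ + 1) (ℤ.*-identityʳ (+ r))) (ℤ.+-comm (+ r) (+ 1)))))))))) ⟩
      (ι (+ r) + 1ℚ) * u
        ≡⟨ trans (*-distribʳ-+ u (ι (+ r)) 1ℚ) (cong₂ _+_ (sym s≡) (*-identityˡ u)) ⟩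
      s + u ∎

    lower : s * s ≤ x
    lower = begin
      s * s                             ≡⟨ cong₂ _*_ s≡ s≡ ⟩
      (ι (+ r) * u) * (ι (+ r) * u)     ≡⟨ ι-square r ⟨
      ι (+ (r ℕ.* r)) * (u * u)         ≤⟨ *-monoʳ-≤-nonNeg (u * u) {{pos⇒nonNeg (u * u) {{uu-pos}}}}
                                             (≤-trans (ι-mono-≤ (ℤ.+≤+ (proj₁ (isqrt-bounds a))))
                                               (subst (λ f → ι f ≤ y) (sym a≡) (floor-lower y))) ⟩
      y * (u * u)                       ≡⟨ yuu≡x ⟩
      x                                 ∎

    upper : x < (s + u) * (s + u)
    upper = begin-strict
      x                                     ≡⟨ yuu≡x ⟨
      y * (u * u)                           <⟨ *-monoˡ-<-pos (u * u) {{uu-pos}}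
                                                 (<-≤-trans (subst (λ f → y < ι (ℤ.suc f)) (sym a≡) (floor-upper y))
                                                   (ι-mono-≤ (ℤ.+≤+ (proj₂ (isqrt-bounds a))))) ⟩
      ι (+ (suc r ℕ.* suc r)) * (u * u)     ≡⟨ ι-square (suc r) ⟩
      (ι (+ suc r) * u) * (ι (+ suc r) * u) ≡⟨ cong₂ _*_ ι-suc ι-suc ⟩
      (s + u) * (s + u)                     ∎

sqrt-close : ∀ m n p q h → 0ℚ < h → + 1 / suc n ≤ h → p < q + h * h →
             sqrtApprox m p < sqrtApprox n q + (h + h)
sqrt-close m n p q h 0<h u≤h p<q+hh = square-cancel-< 0≤t+hh (begin-strict
    s * s                                ≤⟨ proj₁ (sqrtApprox-bounds m p) ⟩
    0ℚ ⊔ p                               ≤⟨ ⊔-lub 0≤q⁺+hh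
                                              (≤-trans (<⇒≤ p<q+hh) (+-monoˡ-≤ (h * h) (p≤q⊔p 0ℚ q))) ⟩
    0ℚ ⊔ q + h * h                       <⟨ +-monoˡ-< (h * h) (proj₂ (sqrtApprox-bounds n q)) ⟩
    (t + u) * (t + u) + h * h            ≤⟨ +-monoˡ-≤ (h * h) (square-mono 0≤t+u (+-monoʳ-≤ t u≤h)) ⟩
    (t + h) * (t + h) + h * h            ≡⟨ +-identityʳ _ ⟨
    (t + h) * (t + h) + h * h + 0ℚ       ≤⟨ +-monoʳ-≤ ((t + h) * (t + h) + h * h) 0≤cross ⟩
    (t + h) * (t + h) + h * h + ((t + h) * h + (t + h) * h)
                                         ≡⟨ solve 2 (λ t h → (t :+ h) :* (t :+ h) :+ h :* h :+ ((t :+ h) :* h :+ (t :+ h) :* h)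
                                                       := (t :+ (h :+ h)) :* (t :+ (h :+ h))) refl t h ⟩
    (t + (h + h)) * (t + (h + h))        ∎)
  where
  open ≤-Reasoning
  open +-*-Solver
  s = sqrtApprox m p
  t = sqrtApprox n q
  u = + 1 / suc n

  0≤+ : ∀ {a b} → 0ℚ ≤ a → 0ℚ ≤ b → 0ℚ ≤ a + b
  0≤+ {a} {b} 0≤a 0≤b = subst (_≤ a + b) (+-identityˡ 0ℚ) (+-mono-≤ 0≤a 0≤b)

  0≤* : ∀ {a b} → 0ℚ ≤ a → 0ℚ ≤ b → 0ℚ ≤ a * b
  0≤* {a} {b} 0≤a 0≤b = nonNegative⁻¹ (a * b)
    {{nonNeg*nonNeg⇒nonNeg a {{ℚ.nonNegative 0≤a}} b {{ℚ.nonNegative 0≤b}}}}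

  0≤h   = <⇒≤ 0<h
  0≤t   = 0≤sqrtApprox n q
  0≤t+u = 0≤+ 0≤t (<⇒≤ (1/suc-pos n))
  0≤t+h = 0≤+ 0≤t 0≤h
  0≤t+hh = 0≤+ 0≤t (0≤+ 0≤h 0≤h)
  0≤q⁺+hh = 0≤+ (p≤p⊔q 0ℚ q) (0≤* 0≤h 0≤h)
  0≤cross = 0≤+ (0≤* 0≤t+h 0≤h) (0≤* 0≤t+h 0≤h)

sqrt-cauchy : ∀ {x} → IsCauchy x → IsCauchy (λ n → sqrtApprox n (x n))
modulus (sqrt-cauchy {x} cx) ε 0<ε =
  let h = ½ * ε
      0<h = half-pos 0<ε
      0<hh = positive⁻¹ (h * h) {{pos*pos⇒pos h {{ℚ.positive 0<h}} h {{ℚ.positive 0<h}}}}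
      N₁ , h₁ = modulus cx (h * h) 0<hh
      N₂ , h₂ = archimedean h 0<h
      near = λ m n N≤m N≤n → subst (λ e → sqrtApprox m (x m) < sqrtApprox n (x n) + e) (half+half ε)
        (sqrt-close m n (x m) (x n) h 0<h (h₂ n (ℕ.m⊔n≤o⇒n≤o N₁ N₂ N≤n))
          (∣p-q∣<ε⇒p<q+ε (h₁ m n (ℕ.m⊔n≤o⇒m≤o N₁ N₂ N≤m) (ℕ.m⊔n≤o⇒m≤o N₁ N₂ N≤n))))
  in N₁ ℕ.⊔ N₂ , λ m n N≤m N≤n →
     p<q+ε⇒∣p-q∣<ε (near m n N≤m N≤n) (near n m N≤n N≤m)

-- On negative arguments √ takes the value 0.
√_ : ℝ → ℝ
√ x = mkℝ (λ n → sqrtApprox n (seq x n)) (sqrt-cauchy (cauchy x))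

infix 9 √_

record ℂ : Set where
  constructor _+i_
  field
    re im : ℝ
open ℂ public

infix 4 _≈ᶜ_
infixl 6 _+ᶜ_
infixl 7 _*ᶜ_

record _≈ᶜ_ (z w : ℂ) : Set where
  constructor mk≈ᶜ
  field
    re-≈ : re z ≈ᴿ re w
    im-≈ : im z ≈ᴿ im w
open _≈ᶜ_ public

0ᶜ 1ᶜ : ℂ
0ᶜ = fromℚ 0ℚ +i fromℚ 0ℚ
1ᶜ = fromℚ 1ℚ +i fromℚ 0ℚ

_+ᶜ_ _*ᶜ_ : ℂ → ℂ → ℂ
z +ᶜ w = (re z +ᴿ re w) +i (im z +ᴿ im w)
z *ᶜ w = (re z *ᴿ re w -ᴿ im z *ᴿ im w) +i (re z *ᴿ im w +ᴿ im z *ᴿ re w)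

∣_∣ᶜ : ℂ → ℝ
∣ z ∣ᶜ = √ (re z *ᴿ re z +ᴿ im z *ᴿ im z)

ℂ-rawSemiring : RawSemiring 0ℓ 0ℓ
ℂ-rawSemiring = record
  { Carrier = ℂ ; _≈_ = _≈ᶜ_ ; _+_ = _+ᶜ_ ; _*_ = _*ᶜ_ ; 0# = 0ᶜ ; 1# = 1ᶜ }

open RawSemiringDefs ℂ-rawSemiring public
  using () renaming (sum to sumᶜ; _^_ to _^ᶜ_)

Matrix : ℕ → Set
Matrix k = Fin k → Fin k → ℂ

infix 4 _≈ᴹ_
infixl 7 _*ᴹ_

_≈ᴹ_ : ∀ {k} → Matrix k → Matrix k → Set
A ≈ᴹ B = ∀ i j → A i j ≈ᶜ B i j

_*ᴹ_ : ∀ {k} → Matrix k → Matrix k → Matrix k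
(A *ᴹ B) i j = sumᶜ λ l → A i l *ᶜ B l j

1ᴹ : ∀ {k} → Matrix k
1ᴹ i j = if does (i ≟ᶠ j) then 1ᶜ else 0ᶜ

Invertible : ∀ {k} → Matrix k → Set
Invertible {k} A = Σ (Matrix k) λ B → A *ᴹ B ≈ᴹ 1ᴹ × B *ᴹ A ≈ᴹ 1ᴹ

frobenius : ∀ {k} → Matrix k → ℝ
frobenius A = √ (sumᴿ λ i → sumᴿ λ j → ∣ A i j ∣ᶜ ^ᴿ 2)

Cond : ∀ {k} (A : Matrix k) → Invertible A → ℝ
Cond A (A⁻¹ , _) = frobenius A *ᴿ frobenius A⁻¹

φ : ℕ → ℕ
φ n = length (filter (λ k → coprime? k n) (applyUpTo suc n))

IsPrimitiveRoot : ℕ → ℂ → Set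
IsPrimitiveRoot n z = z ^ᶜ n ≈ᶜ 1ᶜ × (∀ d → 0 ℕ.< d → d ℕ.< n → ¬ (z ^ᶜ d ≈ᶜ 1ᶜ))

-- Indexing by Fin m with `distinct` and `exhaustive` makes ζ a bijection onto
-- the primitive n-th roots up to _≈ᶜ_: a listing of them in some fixed order.
record ListsPrimitiveRoots (n : ℕ) {m : ℕ} (ζ : Vector ℂ m) : Set where
  field
    isPrimitive : ∀ i → IsPrimitiveRoot n (ζ i)
    distinct    : ∀ i j → ζ i ≈ᶜ ζ j → i ≡ j
    exhaustive  : ∀ z → IsPrimitiveRoot n z → ∃ λ i → z ≈ᶜ ζ i

-- Indices start at 0, so the exponent j - 1 becomes toℕ j.
vandermonde : ∀ {m} → Vector ℂ m → Matrix m
vandermonde ζ i j = ζ i ^ᶜ toℕ j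

{-# OPTIONS --safe #-}
-- Put p = r + 1 and q = p^(k-1), ε = 1 when n = p^k, respectively q = 2^(k-1) p^(ℓ-1), ε = -1 when n = 2^k p^ℓ.
-- Then φ(n) = r q, and for each primitive n-th root ζ the number θ = ε ζ^q is a nontrivial p-th root of unity.
-- Reducing the interpolation polynomial of x^(p q) = ζ^(p q) at ζ modulo the cyclotomic polynomial gives V⁻¹ explicitly:
-- its entry of index t in the column of ζ is (1 / p q) ζ^(-t) (1 - θ^(1 + ⌊t/q⌋)).  That it is a right inverse is a
-- product of two geometric sums; it is then also a left inverse because a polynomial of degree < φ(n) vanishing at
-- φ(n) distinct points is zero.  As ∣1 - θ^a∣² sums to 2 p over 0 < a < p, the squared Frobenius norm of V⁻¹ is
-- φ(n) q (2 p) / (p q)² = 2 (1 - 1/p), while that of V is φ(n)².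
module Submission where

open import Defs

-- In both families the cyclotomic polynomial is the sum of (ε x^q)^a over 0 ≤ a < p, and the sign ε
-- lets one argument serve both. The polynomial is never formed: its vanishing at ζ enters only as
-- the vanishing of a geometric sum in θ. Constructive numbers dictate the rest. Equality of complex
-- numbers cannot be decided, and primitivity only denies that certain powers are 1, without
-- bounding their distance from 1. So nothing is ever divided by u - 1; instead a factor known to be
-- nonzero is cancelled from a vanishing product. The entries of V⁻¹ need only the rational inverses
-- 1/p and 1/q, with ζ⁻¹ written as ζ^(n-1). The roots are known only through their equations, with
-- no trigonometric form, so even ∣ζ∣ = 1 has to be derived from ζ^n = 1.

module CommutativeAlgebra where

  open import Algebra.Bundles using (CommutativeRing; CommutativeSemiring)
  open import Data.Bool.Base using (if_then_else_)
  open import Data.Fin.Base as Fin using (Fin; zero; suc; toℕ)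
  import Data.Fin.Properties as Fin
  open import Data.Nat.Base as ℕ using (ℕ; zero; suc; NonZero; _<_)
  import Data.Nat.Divisibility as ℕ
  import Data.Nat.DivMod as ℕ
  import Data.Nat.Properties as ℕ
  open import Data.Product.Base using (∃-syntax; _×_; _,_)
  open import Function.Base using (_∘_)
  open import Level using (_⊔_)
  open import Relation.Binary.PropositionalEquality as ≡ using (_≡_)
  open import Relation.Nullary using (¬_; does; yes; no; contradiction)

  -- Sums over initial segments and geometric sums.

  module RangeSum {c ℓ} (S : CommutativeSemiring c ℓ) where

    open CommutativeSemiring S hiding (zero)
    open import Algebra.Properties.Semiring.Exp semiring
    open import Algebra.Properties.Semiring.Sum semiring
    open import Algebra.Properties.CommutativeSemigroup +-commutativeSemigroup using (xy∙z≈xz∙y)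
    open import Relation.Binary.Reasoning.Setoid setoid

    ∑< : ℕ → (ℕ → Carrier) → Carrier
    ∑< n f = sum {n} (f ∘ toℕ)

    ∑<-cong : ∀ n {f g} → (∀ t → t < n → f t ≈ g t) → ∑< n f ≈ ∑< n g
    ∑<-cong n f≈g = sum-cong-≋ λ i → f≈g (toℕ i) (Fin.toℕ<n i)

    ∑<-++ : ∀ m n f → ∑< (m ℕ.+ n) f ≈ ∑< m f + ∑< n (f ∘ (m ℕ.+_))
    ∑<-++ zero    n f = sym (+-identityˡ _)
    ∑<-++ (suc m) n f = trans (+-congˡ (∑<-++ m n (f ∘ suc))) (sym (+-assoc _ _ _))

    ∑<-last : ∀ n f → ∑< (suc n) f ≈ ∑< n f + f n
    ∑<-last zero    f = +-comm _ _
    ∑<-last (suc n) f = trans (+-congˡ (∑<-last n (f ∘ suc))) (sym (+-assoc _ _ _))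

    -- The entries of V⁻¹ depend on `t` through its quotient and remainder by `q`. Induction peels
    -- off the first block of `q` indices; shifting by `q` raises the quotient by one and keeps the
    -- remainder.
    ∑<-divMod : ∀ a q .{{_ : NonZero q}} (f : ℕ → ℕ → Carrier) →
                ∑< (a ℕ.* q) (λ t → f (t ℕ./ q) (t ℕ.% q)) ≈ ∑< a (λ i → ∑< q (f i))
    ∑<-divMod zero    q f = refl
    ∑<-divMod (suc a) q f = trans (∑<-++ q (a ℕ.* q) F) (+-cong
      (∑<-cong q {F} {f 0} λ t t<q → reflexive (≡.cong₂ f (ℕ.m<n⇒m/n≡0 t<q) (ℕ.m<n⇒m%n≡m t<q)))
      (trans
        (∑<-cong (a ℕ.* q) {F ∘ (q ℕ.+_)} {λ t → f (suc (t ℕ./ q)) (t ℕ.% q)} λ t _ →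
            reflexive (≡.cong₂ f ([q+t]/q t) ([q+t]%q t)))
        (∑<-divMod a q (f ∘ suc))))
      where
      F = λ t → f (t ℕ./ q) (t ℕ.% q)

      [q+t]/q : ∀ t → (q ℕ.+ t) ℕ./ q ≡ suc (t ℕ./ q)
      [q+t]/q t = ≡.trans (ℕ.+-distrib-/-∣ˡ t ℕ.∣-refl) (≡.cong (ℕ._+ t ℕ./ q) (ℕ.n/n≡1 q))

      [q+t]%q : ∀ t → (q ℕ.+ t) ℕ.% q ≡ t ℕ.% q
      [q+t]%q t = ≡.trans (≡.cong (ℕ._% q) (ℕ.+-comm q t)) (ℕ.[m+n]%n≡m%n t q)

    *-distribˡ-∑< : ∀ n x f → x * ∑< n f ≈ ∑< n (λ t → x * f t)
    *-distribˡ-∑< n x f = *-distribˡ-sum {n} x (f ∘ toℕ)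

    *-distribʳ-∑< : ∀ n x f → ∑< n f * x ≈ ∑< n (λ t → f t * x)
    *-distribʳ-∑< n x f = *-distribʳ-sum {n} x (f ∘ toℕ)

    geometric : Carrier → ℕ → Carrier
    geometric u n = ∑< n (u ^_)

    1^n≈1 : ∀ n → 1# ^ n ≈ 1#
    1^n≈1 zero    = refl
    1^n≈1 (suc n) = trans (*-identityˡ _) (1^n≈1 n)

    -- (u - 1) (1 + ⋯ + u ^ (n - 1)) = u ^ n - 1 with both sides moved so that no subtraction occurs.
    geometric-telescope : ∀ u n → u * geometric u n + 1# ≈ geometric u n + u ^ n
    geometric-telescope u zero    = +-congʳ (zeroʳ u)
    geometric-telescope u (suc n) = begin
      u * geometric u (suc n) + 1#            ≈⟨ +-congʳ (*-congˡ (∑<-last n (u ^_))) ⟩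
      u * (geometric u n + u ^ n) + 1#        ≈⟨ +-congʳ (distribˡ u _ _) ⟩
      u * geometric u n + u * u ^ n + 1#      ≈⟨ xy∙z≈xz∙y _ _ _ ⟩
      u * geometric u n + 1# + u * u ^ n      ≈⟨ +-congʳ (geometric-telescope u n) ⟩
      geometric u n + u ^ n + u * u ^ n       ≈⟨ +-congʳ (∑<-last n (u ^_)) ⟨
      geometric u (suc n) + u ^ suc n         ∎

  -- The disjunctive form, that one of two factors vanishes, would demand a decision that Cauchy
  -- reals do not allow. The form with a denied factor holds for them and suffices here.
  NoZeroDivisors : ∀ {c ℓ} → CommutativeRing c ℓ → Set (c ⊔ ℓ)
  NoZeroDivisors R = ∀ x y → x * y ≈ 0# → ¬ (x ≈ 0#) → y ≈ 0#
    where open CommutativeRing R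

  -- Roots of unity, polynomial roots and Vandermonde inverses over such a ring.

  module DenialDomain {c ℓ} (R : CommutativeRing c ℓ) (cancel : NoZeroDivisors R) where

    open CommutativeRing R hiding (zero)
    open RangeSum commutativeSemiring public
    open import Algebra.Properties.CommutativeSemiring.Exp commutativeSemiring
    open import Algebra.Properties.Semiring.Sum semiring
    open import Algebra.Properties.Ring ring
    open import Algebra.Properties.CommutativeSemigroup *-commutativeSemigroup as ×-Comm using ()
    open import Algebra.Solver.Ring.NaturalCoefficients.Default commutativeSemiring
    open import Relation.Binary.Reasoning.Setoid setoid

    *-cancelʳ-≉ : ∀ {x y} z → x * z ≈ y * z → ¬ (x ≈ y) → z ≈ 0#
    *-cancelʳ-≉ {x} {y} z xz≈yz x≉y = cancel (x - y) z
      (trans ([y-z]x≈yx-zx z x y) (x≈y⇒x∙y⁻¹≈ε xz≈yz)) λ x-y≈0 → x≉y (x∙y⁻¹≈ε⇒x≈y x y x-y≈0)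

    -- The factor `1#` stays on the right so that the result fits the hypothesis of `*-cancelʳ-≉`.
    *geometric : ∀ {u} n → u ^ n ≈ 1# → u * geometric u n ≈ 1# * geometric u n
    *geometric {u} n uⁿ≈1 = trans
      (+-cancelʳ 1# _ _ (trans (geometric-telescope u n) (+-congˡ uⁿ≈1))) (sym (*-identityˡ _))

    geometric≈0 : ∀ {u} n → u ^ n ≈ 1# → ¬ (u ≈ 1#) → geometric u n ≈ 0#
    geometric≈0 n uⁿ≈1 = *-cancelʳ-≉ _ (*geometric n uⁿ≈1)

    -- Classically one would ask whether u^q = 1: if so the first factor vanishes, otherwise the
    -- second. That question is undecidable here, so the product is treated whole: it is the
    -- geometric sum of length q p, and multiplication by `u` fixes it.
    geometric*geometric≈0 : ∀ {u} q p → (u ^ q) ^ p ≈ 1# → ¬ (u ≈ 1#) →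
                            geometric u q * geometric (u ^ q) p ≈ 0#
    geometric*geometric≈0 {u} q p uᵖ≈1 = *-cancelʳ-≉ _ (+-cancelʳ H _ _ (begin
      u * (G * H) + H                 ≈⟨ solve 3 (λ u g h → u :* (g :* h) :+ h := (u :* g :+ con 1) :* h) refl u G H ⟩
      (u * G + 1#) * H                ≈⟨ *-congʳ (geometric-telescope u q) ⟩
      (G + u ^ q) * H                 ≈⟨ distribʳ H G (u ^ q) ⟩
      G * H + u ^ q * H               ≈⟨ +-congˡ (*geometric p uᵖ≈1) ⟩
      G * H + 1# * H                  ≈⟨ +-cong (sym (*-identityˡ _)) (*-identityˡ H) ⟩
      1# * (G * H) + H                ∎))
      where
      G = geometric u q
      H = geometric (u ^ q) p

    evaluate : ∀ {k} → (Fin k → Carrier) → Carrier → Carrier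
    evaluate f x = sum λ j → f j * x ^ toℕ j

    evaluate-∷ : ∀ {k} (f : Fin (suc k) → Carrier) x → evaluate f x ≈ f zero + x * evaluate (f ∘ suc) x
    evaluate-∷ {k} f x = +-cong (*-identityʳ (f zero)) (trans
      (sum-cong-≋ {k} λ j → ×-Comm.x∙yz≈y∙xz (f (suc j)) x (x ^ toℕ j))
      (sym (*-distribˡ-sum {k} x λ j → f (suc j) * x ^ toℕ j)))

    evaluate-0 : ∀ {k} {f : Fin k → Carrier} x → (∀ j → f j ≈ 0#) → evaluate f x ≈ 0#
    evaluate-0 {k} x f≈0 = trans (sum-cong-≋ {k} λ j → trans (*-congʳ (f≈0 j)) (zeroˡ _)) (sum-replicate-zero k)

    -- Synthetic division: g is the quotient (f - f(a)) / (x - a).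
    divide : ∀ {k} (f : Fin (suc k) → Carrier) a → ∃[ g ]
      ((∀ x → evaluate f x + a * evaluate {k} g x ≈ evaluate f a + x * evaluate g x)
        × ((∀ j → g j ≈ 0#) → ∀ j → f (suc j) ≈ 0#))
    divide {zero} f a = (λ ()) , (λ x → +-cong refl (trans (zeroʳ a) (sym (zeroʳ x)))) , λ _ ()
    divide {suc k} f a with divide (f ∘ suc) a
    ... | g , g-quotient , g≈0⇒ = h , h-quotient , h≈0⇒
      where
      T = evaluate (f ∘ suc)
      G = evaluate g

      h : Fin (suc k) → Carrier
      h zero    = T a
      h (suc j) = g j

      h-quotient : ∀ x → evaluate f x + a * evaluate h x ≈ evaluate f a + x * evaluate h x
      h-quotient x = begin
        evaluate f x + a * evaluate h x
          ≈⟨ +-cong (evaluate-∷ f x) (*-congˡ (evaluate-∷ h x)) ⟩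
        f zero + x * T x + a * (T a + x * G x)
          ≈⟨ solve 6 (λ c x tx a ta gx → c :+ x :* tx :+ a :* (ta :+ x :* gx) := c :+ a :* ta :+ x :* (tx :+ a :* gx))
               refl (f zero) x (T x) a (T a) (G x) ⟩
        f zero + a * T a + x * (T x + a * G x)
          ≈⟨ +-cong (sym (evaluate-∷ f a)) (*-congˡ (trans (g-quotient x) (sym (evaluate-∷ h x)))) ⟩
        evaluate f a + x * evaluate h x ∎

      h≈0⇒ : (∀ j → h j ≈ 0#) → ∀ j → f (suc j) ≈ 0#
      h≈0⇒ h≈0 (suc j) = g≈0⇒ (h≈0 ∘ suc) j
      h≈0⇒ h≈0 zero    = begin
        f (suc zero)                               ≈⟨ +-identityʳ _ ⟨
        f (suc zero) + 0#                          ≈⟨ +-congˡ (trans (*-congˡ (evaluate-0 {f = λ j → f (suc (suc j))} a (g≈0⇒ (h≈0 ∘ suc)))) (zeroʳ a)) ⟨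
        f (suc zero) + a * evaluate {k} (λ j → f (suc (suc j))) a ≈⟨ evaluate-∷ (f ∘ suc) a ⟨
        T a                                        ≈⟨ h≈0 zero ⟩
        0#                                         ∎

    -- This takes the place of the Vandermonde determinant. If f vanishes at a and at another node
    -- b, the division identity reads a g(b) = b g(b), so g(b) = 0 because a and b differ; induction
    -- then applies to g. The constant coefficient follows from f(a) = 0 once the others are gone.
    evaluate≈0⇒≈0 : ∀ {k} (f r : Fin k → Carrier) → (∀ i j → r i ≈ r j → i ≡ j) →
                    (∀ i → evaluate f (r i) ≈ 0#) → ∀ j → f j ≈ 0#
    evaluate≈0⇒≈0 {suc k} f r r-inj roots with divide f (r zero)
    ... | g , g-quotient , g≈0⇒ = f≈0
      where
      a = r zero
      g≈0 : ∀ j → g j ≈ 0#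
      g≈0 = evaluate≈0⇒≈0 g (r ∘ suc) (λ i j eq → Fin.suc-injective (r-inj (suc i) (suc j) eq)) λ i →
        *-cancelʳ-≉ _ (begin
          a * evaluate g (r (suc i))                     ≈⟨ +-identityˡ _ ⟨
          0# + a * evaluate g (r (suc i))                ≈⟨ +-congʳ (roots (suc i)) ⟨
          evaluate f (r (suc i)) + a * evaluate g (r (suc i)) ≈⟨ g-quotient (r (suc i)) ⟩
          evaluate f a + r (suc i) * evaluate g (r (suc i)) ≈⟨ +-congʳ (roots zero) ⟩
          0# + r (suc i) * evaluate g (r (suc i))        ≈⟨ +-identityˡ _ ⟩
          r (suc i) * evaluate g (r (suc i))             ∎)
        λ a≈r → contradiction (r-inj zero (suc i) a≈r) λ ()

      f≈0 : ∀ j → f j ≈ 0#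
      f≈0 (suc j) = g≈0⇒ g≈0 j
      f≈0 zero    = begin
        f zero                                ≈⟨ +-identityʳ _ ⟨
        f zero + 0#                           ≈⟨ +-congˡ (trans (*-congˡ (evaluate-0 {f = f ∘ suc} a (g≈0⇒ g≈0))) (zeroʳ a)) ⟨
        f zero + a * evaluate (f ∘ suc) a     ≈⟨ evaluate-∷ f a ⟨
        evaluate f a                          ≈⟨ roots zero ⟩
        0#                                    ∎

    -- One-sided and explicit inverses of Vandermonde matrices.

    δ : ∀ {k} → Fin k → Fin k → Carrier
    δ i j = if does (i Fin.≟ j) then 1# else 0#

    δ-sym : ∀ {k} (i j : Fin k) → δ i j ≡ δ j i
    δ-sym i j with i Fin.≟ j | j Fin.≟ i
    ... | yes _   | yes _   = ≡.refl
    ... | no  _   | no  _   = ≡.refl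
    ... | yes i≡j | no  j≢i = contradiction (≡.sym i≡j) j≢i
    ... | no  i≢j | yes j≡i = contradiction (≡.sym j≡i) i≢j

    sum-δ : ∀ {k} (i : Fin k) (x : Fin k → Carrier) → sum (λ j → δ i j * x j) ≈ x i
    sum-δ {suc k} zero    x = trans
      (+-cong (*-identityˡ _) (trans (sum-cong-≋ {k} λ j → zeroˡ (x (suc j))) (sum-replicate-zero k))) (+-identityʳ _)
    sum-δ {suc k} (suc i) x = trans (+-cong (zeroˡ _) (sum-δ i (x ∘ suc))) (+-identityˡ _)

    -- The case split is on indices, where equality is decidable, and not on ring elements.
    ≈δ : ∀ {k} (i j : Fin k) {x} → (i ≡ j → x ≈ 1#) → (¬ i ≡ j → x ≈ 0#) → x ≈ δ i j
    ≈δ i j ≡⇒1 ≢⇒0 with i Fin.≟ j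
    ... | yes i≡j = ≡⇒1 i≡j
    ... | no  i≢j = ≢⇒0 i≢j

    -- From V W = 1 follows V (W V - 1) = 0. This says that each column of W V - 1, read as a list
    -- of coefficients, is a polynomial vanishing at all `k` nodes.
    vandermonde-leftInverse : ∀ {k} (r : Fin k → Carrier) (W : Fin k → Fin k → Carrier) →
      (∀ i j → r i ≈ r j → i ≡ j) →
      (∀ i j → sum (λ l → r i ^ toℕ l * W l j) ≈ δ i j) →
      ∀ i j → sum (λ l → W i l * r l ^ toℕ j) ≈ δ i j
    vandermonde-leftInverse {k} r W r-inj right i j =
      x∙y⁻¹≈ε⇒x≈y _ _ (evaluate≈0⇒≈0 (λ a → WV a - δ a j) r r-inj root i)
      where
      WV : Fin k → Carrier
      WV a = sum λ l → W a l * r l ^ toℕ j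

      evaluate-WV : ∀ l → evaluate WV (r l) ≈ r l ^ toℕ j
      evaluate-WV l = begin
        sum (λ a → WV a * r l ^ toℕ a)
          ≈⟨ sum-cong-≋ {k} (λ a → *-distribʳ-sum {k} (r l ^ toℕ a) λ b → W a b * r b ^ toℕ j) ⟩
        sum (λ a → sum λ b → W a b * r b ^ toℕ j * r l ^ toℕ a)
          ≈⟨ ∑-comm (λ a b → W a b * r b ^ toℕ j * r l ^ toℕ a) ⟩
        sum (λ b → sum λ a → W a b * r b ^ toℕ j * r l ^ toℕ a)
          ≈⟨ sum-cong-≋ {k} (λ b → sum-cong-≋ {k} λ a → ×-Comm.xy∙z≈zx∙y (W a b) (r b ^ toℕ j) (r l ^ toℕ a)) ⟩
        sum (λ b → sum λ a → r l ^ toℕ a * W a b * r b ^ toℕ j)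
          ≈⟨ sum-cong-≋ {k} (λ b → *-distribʳ-sum {k} (r b ^ toℕ j) λ a → r l ^ toℕ a * W a b) ⟨
        sum (λ b → sum (λ a → r l ^ toℕ a * W a b) * r b ^ toℕ j)
          ≈⟨ sum-cong-≋ {k} (λ b → *-congʳ (right l b)) ⟩
        sum (λ b → δ l b * r b ^ toℕ j)
          ≈⟨ sum-δ l (λ b → r b ^ toℕ j) ⟩
        r l ^ toℕ j ∎

      root : ∀ l → evaluate (λ a → WV a - δ a j) (r l) ≈ 0#
      root l = +-cancelʳ (r l ^ toℕ j) _ _ (begin
        evaluate (λ a → WV a - δ a j) (r l) + r l ^ toℕ j
          ≈⟨ +-congˡ (sum-δ j (λ a → r l ^ toℕ a)) ⟨
        evaluate (λ a → WV a - δ a j) (r l) + sum (λ a → δ j a * r l ^ toℕ a)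
          ≈⟨ ∑-distrib-+ {k} (λ a → (WV a - δ a j) * r l ^ toℕ a) (λ a → δ j a * r l ^ toℕ a) ⟨
        sum (λ a → (WV a - δ a j) * r l ^ toℕ a + δ j a * r l ^ toℕ a)
          ≈⟨ sum-cong-≋ {k} (λ a → trans (sym (distribʳ (r l ^ toℕ a) _ _)) (*-congʳ (begin
               WV a - δ a j + δ j a   ≡⟨ ≡.cong (WV a - δ a j +_) (δ-sym j a) ⟩
               WV a - δ a j + δ a j   ≈⟨ //-rightDividesˡ (δ a j) (WV a) ⟩
               WV a                   ∎))) ⟩
        evaluate WV (r l)
          ≈⟨ trans (evaluate-WV l) (sym (+-identityˡ _)) ⟩
        0# + r l ^ toℕ j ∎)

    -- Since `ω` inverts `θ`, this is θ^(-r) = θ, valid because θ^(r+1) = 1.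
    inverse-^ : ∀ {ω θ} r → ω * θ ≈ 1# → θ ^ suc r ≈ 1# → ω ^ r ≈ θ
    inverse-^ {ω} {θ} r ωθ≈1 θᵖ≈1 = begin
      ω ^ r                  ≈⟨ *-identityʳ _ ⟨
      ω ^ r * 1#             ≈⟨ *-congˡ θᵖ≈1 ⟨
      ω ^ r * (θ * θ ^ r)    ≈⟨ ×-Comm.x∙yz≈xz∙y (ω ^ r) θ (θ ^ r) ⟩
      ω ^ r * θ ^ r * θ      ≈⟨ *-congʳ (^-distrib-* ω θ r) ⟨
      (ω * θ) ^ r * θ        ≈⟨ *-congʳ (trans (^-congˡ r ωθ≈1) (1^n≈1 r)) ⟩
      1# * θ                 ≈⟨ *-identityˡ θ ⟩
      θ                      ∎

    -- The entry of V V⁻¹ in the row of z and the column of x⁻¹, up to a constant; θ′, θ, ω are attached to z, x⁻¹, x.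
    interpolation-sum : ∀ r q .{{_ : NonZero q}} {z x θ′ θ ω} →
      (z * x) ^ q ≈ θ′ * ω → ω * θ ≈ 1# → θ ^ suc r ≈ 1# → geometric θ′ (suc r) ≈ 0# →
      ∑< (r ℕ.* q) (λ t → z ^ t * (x ^ t * (1# - θ ^ suc (t ℕ./ q))))
        ≈ geometric (z * x) q * geometric ((z * x) ^ q) (suc r)
    interpolation-sum r q {z} {x} {θ′} {θ} {ω} ν≈ ωθ≈1 θᵖ≈1 vanish = begin
      ∑< (r ℕ.* q) (λ t → z ^ t * (x ^ t * (1# - θ ^ suc (t ℕ./ q))))
        ≈⟨ ∑<-cong (r ℕ.* q) (λ t _ → term t) ⟩
      ∑< (r ℕ.* q) (λ t → u ^ (t ℕ.% q) * E (t ℕ./ q))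
        ≈⟨ ∑<-divMod r q (λ a b → u ^ b * E a) ⟩
      ∑< r (λ a → ∑< q (λ b → u ^ b * E a))
        ≈⟨ ∑<-cong r (λ a _ → *-distribʳ-∑< q (E a) (u ^_)) ⟨
      ∑< r (λ a → geometric u q * E a)
        ≈⟨ *-distribˡ-∑< r (geometric u q) E ⟨
      geometric u q * ∑< r E
        ≈⟨ *-congˡ ∑E ⟩
      geometric u q * geometric ν (suc r) ∎
      where
      u = z * x
      ν = u ^ q
      E : ℕ → Carrier
      E a = ν ^ a - θ′ ^ a * θ

      -- Because ν θ = θ′, the product of ν^a and θ^(a+1) is θ′^a θ; this is how the subtracted part
      -- of `E` loses its dependence on `ν`.
      νᵃθᵃ : ∀ a → ν ^ a * θ ^ a ≈ θ′ ^ a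
      νᵃθᵃ a = begin
        ν ^ a * θ ^ a          ≈⟨ ^-distrib-* ν θ a ⟨
        (ν * θ) ^ a            ≈⟨ ^-congˡ a (trans (*-congʳ ν≈) (trans (*-assoc θ′ ω θ) (trans (*-congˡ ωθ≈1) (*-identityʳ θ′)))) ⟩
        θ′ ^ a                 ∎

      νʳ : ν ^ r ≈ θ′ ^ r * θ
      νʳ = trans (^-congˡ r ν≈) (trans (^-distrib-* θ′ ω r) (*-congˡ (inverse-^ r ωθ≈1 θᵖ≈1)))

      term : ∀ t → z ^ t * (x ^ t * (1# - θ ^ suc (t ℕ./ q))) ≈ u ^ (t ℕ.% q) * E (t ℕ./ q)
      term t = begin
        z ^ t * (x ^ t * (1# - θ ^ suc a))       ≈⟨ *-assoc _ _ _ ⟨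
        z ^ t * x ^ t * (1# - θ ^ suc a)         ≈⟨ *-congʳ (^-distrib-* z x t) ⟨
        u ^ t * (1# - θ ^ suc a)                 ≈⟨ *-congʳ (^-congʳ u (ℕ.m≡m%n+[m/n]*n t q)) ⟩
        u ^ (b ℕ.+ a ℕ.* q) * (1# - θ ^ suc a)   ≈⟨ *-congʳ (^-homo-* u b (a ℕ.* q)) ⟩
        u ^ b * u ^ (a ℕ.* q) * (1# - θ ^ suc a) ≈⟨ *-congʳ (*-congˡ (trans (^-congʳ u (ℕ.*-comm a q)) (sym (^-assocʳ u q a)))) ⟩
        u ^ b * ν ^ a * (1# - θ ^ suc a)         ≈⟨ *-assoc _ _ _ ⟩
        u ^ b * (ν ^ a * (1# - θ ^ suc a))       ≈⟨ *-congˡ (x[y-z]≈xy-xz (ν ^ a) 1# (θ ^ suc a)) ⟩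
        u ^ b * (ν ^ a * 1# - ν ^ a * (θ * θ ^ a)) ≈⟨ *-congˡ (+-cong (*-identityʳ _) (-‿cong
                                                      (trans (×-Comm.x∙yz≈xz∙y (ν ^ a) θ (θ ^ a)) (*-congʳ (νᵃθᵃ a))))) ⟩
        u ^ b * E a                              ∎
        where
        a = t ℕ./ q
        b = t ℕ.% q

      -- The range of `a` stops at r - 1, one short of a full geometric sum in `ν`. The full sum of
      -- the powers of `θ′` vanishes, so subtracting θ times the sum up to r - 1 amounts to adding
      -- θ′^r θ, and by `νʳ` that is the missing term ν^r.
      ∑E : ∑< r E ≈ geometric ν (suc r)
      ∑E = begin
        ∑< r E
          ≈⟨ +-identityʳ _ ⟨
        ∑< r E + 0#
          ≈⟨ +-congˡ (trans (*-congʳ vanish) (zeroˡ θ)) ⟨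
        ∑< r E + geometric θ′ (suc r) * θ
          ≈⟨ +-congˡ (trans (*-congʳ (∑<-last r (θ′ ^_))) (distribʳ θ _ _)) ⟩
        ∑< r E + (geometric θ′ r * θ + θ′ ^ r * θ)
          ≈⟨ +-assoc _ _ _ ⟨
        ∑< r E + geometric θ′ r * θ + θ′ ^ r * θ
          ≈⟨ +-cong (+-congˡ (*-distribʳ-∑< r θ (θ′ ^_))) (sym νʳ) ⟩
        ∑< r E + ∑< r (λ a → θ′ ^ a * θ) + ν ^ r
          ≈⟨ +-congʳ (∑-distrib-+ {r} (E ∘ toℕ) (λ i → θ′ ^ toℕ i * θ)) ⟨
        ∑< r (λ a → E a + θ′ ^ a * θ) + ν ^ r
          ≈⟨ +-congʳ (∑<-cong r (λ a _ → //-rightDividesˡ (θ′ ^ a * θ) (ν ^ a))) ⟩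
        geometric ν r + ν ^ r
          ≈⟨ ∑<-last r (ν ^_) ⟨
        geometric ν (suc r) ∎

    -- The interpolation polynomial at ζ is 1/(p q) times the sum of ζ^(-t) x^t over t < p q. Modulo
    -- the cyclotomic polynomial its top block, of exponents r q + b with b < q, folds back onto the
    -- lower ones: the coefficient of x^(a q + b) loses ε^a ζ^(-r q - b), which is θ^(a+1) times the
    -- coefficient itself. Here `ξ` holds the ζ⁻¹, and `c` is meant to be 1/(p q).
    inverseEntry : ∀ {k} (q : ℕ) .{{_ : NonZero q}} (ξ θ : Fin k → Carrier) → Carrier → ℕ → Fin k → Carrier
    inverseEntry q ξ θ c t i = c * (ξ i ^ t * (1# - θ i ^ suc (t ℕ./ q)))

    module _ (r q : ℕ) .{{_ : NonZero q}} {ζ ξ θ ω : Fin (r ℕ.* q) → Carrier} {c : Carrier}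
      (ζ-injective : ∀ i j → ζ i ≈ ζ j → i ≡ j)
      (ζξ≈1 : ∀ i → ζ i * ξ i ≈ 1#)
      (ωθ≈1 : ∀ i → ω i * θ i ≈ 1#)
      (ζξ^q≈θω : ∀ i j → (ζ i * ξ j) ^ q ≈ θ i * ω j)
      (θᵖ≈1 : ∀ i → θ i ^ suc r ≈ 1#)
      (θ≉1 : ∀ i → ¬ (θ i ≈ 1#))
      (c-inverse : c * (∑< q (λ _ → 1#) * ∑< (suc r) (λ _ → 1#)) ≈ 1#)
      where

      ζξ≉1 : ∀ {i j} → ¬ i ≡ j → ¬ (ζ i * ξ j ≈ 1#)
      ζξ≉1 {i} {j} i≢j u≈1 = i≢j (ζ-injective i j (begin
        ζ i                    ≈⟨ *-identityʳ (ζ i) ⟨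
        ζ i * 1#               ≈⟨ *-congˡ (ζξ≈1 j) ⟨
        ζ i * (ζ j * ξ j)      ≈⟨ ×-Comm.x∙yz≈xz∙y (ζ i) (ζ j) (ξ j) ⟩
        ζ i * ξ j * ζ j        ≈⟨ *-congʳ u≈1 ⟩
        1# * ζ j               ≈⟨ *-identityˡ (ζ j) ⟩
        ζ j                    ∎))

      θω^p≈1 : ∀ i j → (θ i * ω j) ^ suc r ≈ 1#
      θω^p≈1 i j = begin
        (θ i * ω j) ^ suc r          ≈⟨ ^-distrib-* (θ i) (ω j) (suc r) ⟩
        -- Both p-th powers of θ equal 1, so θ i may be exchanged for θ j, the inverse of ω j.
        θ i ^ suc r * ω j ^ suc r    ≈⟨ *-congʳ (trans (θᵖ≈1 i) (sym (θᵖ≈1 j))) ⟩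
        θ j ^ suc r * ω j ^ suc r    ≈⟨ ^-distrib-* (θ j) (ω j) (suc r) ⟨
        (θ j * ω j) ^ suc r          ≈⟨ ^-congˡ (suc r) (trans (*-comm (θ j) (ω j)) (ωθ≈1 j)) ⟩
        1# ^ suc r                   ≈⟨ 1^n≈1 (suc r) ⟩
        1#                           ∎

      geometric-1 : ∀ {u} n → u ≈ 1# → geometric u n ≈ ∑< n (λ _ → 1#)
      geometric-1 {u} n u≈1 = ∑<-cong n {u ^_} {λ _ → 1#} λ t _ → trans (^-congˡ t u≈1) (1^n≈1 t)

      -- Everything depends on u = ζ i ξ j. On the diagonal u = 1, so the two geometric sums count q
      -- and p terms and `c` cancels them. Off the diagonal u is not 1, while (u^q)^p = 1, so their
      -- product vanishes.
      vandermonde-rightInverse : ∀ i j → sum {r ℕ.* q} (λ l → ζ i ^ toℕ l * inverseEntry q ξ θ c (toℕ l) j) ≈ δ i j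
      vandermonde-rightInverse i j = begin
        ∑< (r ℕ.* q) (λ t → ζ i ^ t * (c * E t))
          ≈⟨ ∑<-cong (r ℕ.* q) {λ t → ζ i ^ t * (c * E t)} {λ t → c * (ζ i ^ t * E t)}
               (λ t _ → ×-Comm.x∙yz≈y∙xz (ζ i ^ t) c (E t)) ⟩
        ∑< (r ℕ.* q) (λ t → c * (ζ i ^ t * E t))
          ≈⟨ *-distribˡ-∑< (r ℕ.* q) c (λ t → ζ i ^ t * E t) ⟨
        c * ∑< (r ℕ.* q) (λ t → ζ i ^ t * E t)
          ≈⟨ *-congˡ (interpolation-sum r q (ζξ^q≈θω i j) (ωθ≈1 j) (θᵖ≈1 j) (geometric≈0 (suc r) (θᵖ≈1 i) (θ≉1 i))) ⟩
        c * (geometric u q * geometric (u ^ q) (suc r))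
          ≈⟨ ≈δ i j on-diagonal off-diagonal ⟩
        δ i j ∎
        where
        u = ζ i * ξ j
        E : ℕ → Carrier
        E t = ξ j ^ t * (1# - θ j ^ suc (t ℕ./ q))

        on-diagonal : i ≡ j → c * (geometric u q * geometric (u ^ q) (suc r)) ≈ 1#
        on-diagonal ≡.refl = trans (*-congˡ (*-cong
          (geometric-1 q (ζξ≈1 i))
          (geometric-1 (suc r) (trans (^-congˡ q (ζξ≈1 i)) (1^n≈1 q))))) c-inverse

        off-diagonal : ¬ i ≡ j → c * (geometric u q * geometric (u ^ q) (suc r)) ≈ 0#
        off-diagonal i≢j = trans (*-congˡ (geometric*geometric≈0 q (suc r)
          (trans (^-congˡ (suc r) (ζξ^q≈θω i j)) (θω^p≈1 i j)) (ζξ≉1 i≢j))) (zeroʳ c)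

    u²≈1⇒u≈-1 : ∀ {u} → u ^ 2 ≈ 1# → ¬ (u ≈ 1#) → u ≈ - 1#
    u²≈1⇒u≈-1 {u} u²≈1 u≉1 = +-inverseʳ-unique 1# u (begin
      1# + u                ≈⟨ +-congˡ (trans (+-identityʳ _) (*-identityʳ u)) ⟨
      geometric u 2         ≈⟨ geometric≈0 2 u²≈1 u≉1 ⟩
      0#                    ∎)

    odd-power : ∀ {ε r} → ε * ε ≈ 1# → 2 ℕ.∣ r → ε ^ suc r ≈ ε
    odd-power {ε} εε≈1 (ℕ.divides-refl k) = begin
      ε * ε ^ (k ℕ.* 2)     ≈⟨ *-congˡ (^-congʳ ε (ℕ.*-comm k 2)) ⟩
      ε * ε ^ (2 ℕ.* k)     ≈⟨ *-congˡ (^-assocʳ ε 2 k) ⟨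
      ε * (ε ^ 2) ^ k       ≈⟨ *-congˡ (^-congˡ k (trans (*-congˡ (*-identityʳ ε)) εε≈1)) ⟩
      ε * 1# ^ k            ≈⟨ trans (*-congˡ (1^n≈1 k)) (*-identityʳ ε) ⟩
      ε                     ∎

    -1*-1≈1 : - 1# * - 1# ≈ 1#
    -1*-1≈1 = trans (-1*x≈-x (- 1#)) (-‿involutive 1#)

-- Euler's totient for the two families.

module Totient where

  open CommutativeAlgebra
  open import Data.Bool.Base using (true; false; if_then_else_)
  open import Data.List.Base using (applyUpTo; filter; length)
  open import Data.Nat.Base using (ℕ; zero; suc; _+_; _*_; _^_; s≤s; nonTrivial⇒≢1)
  open import Data.Nat.Coprimality as Coprime using (Coprime; coprime?)
  open import Data.Nat.Divisibility using (_∣_; ∣-refl; ∣-trans; ∣m∣n⇒∣m+n; ∣m+n∣m⇒∣n; m∣m*n; n∣m*n; _∣?_; _∣0)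
  open import Data.Nat.Primality using (Prime; irreducible[2]; prime⇒nonTrivial)
  import Data.Nat.Properties as ℕ
  open import Data.Nat.Tactic.RingSolver using (solve-∀)
  open import Data.Product.Base using (_,_)
  open import Data.Sum.Base using (_⊎_; inj₁; inj₂)
  open import Relation.Binary.PropositionalEquality
  open import Relation.Nullary using (¬_; Dec; does; yes; no; contradiction)
  open import Relation.Unary using (Decidable)

  open RangeSum ℕ.+-*-commutativeSemiring using (∑<; ∑<-cong; ∑<-++; ∑<-last)

  indicator : ∀ {A : Set} → Dec A → ℕ
  indicator A? = if does A? then 1 else 0

  indicator-yes : ∀ {A : Set} (A? : Dec A) → A → indicator A? ≡ 1
  indicator-yes (yes _) a = refl
  indicator-yes (no ¬a) a = contradiction a ¬a

  indicator-no : ∀ {A : Set} (A? : Dec A) → ¬ A → indicator A? ≡ 0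
  indicator-no (yes a) ¬a = contradiction a ¬a
  indicator-no (no _)  ¬a = refl

  indicator-⇔ : ∀ {A B : Set} (A? : Dec A) (B? : Dec B) → (A → B) → (B → A) → indicator A? ≡ indicator B?
  indicator-⇔ (yes a) B? to from = sym (indicator-yes B? (to a))
  indicator-⇔ (no ¬a) B? to from = sym (indicator-no B? λ b → ¬a (from b))

  length-filter-applyUpTo : ∀ {P : ℕ → Set} (P? : Decidable P) f n →
    length (filter P? (applyUpTo f n)) ≡ ∑< n (λ t → indicator (P? (f t)))
  length-filter-applyUpTo P? f zero = refl
  length-filter-applyUpTo P? f (suc n) with does (P? (f 0))
  ... | true  = cong suc (length-filter-applyUpTo P? (λ t → f (suc t)) n)
  ... | false = length-filter-applyUpTo P? (λ t → f (suc t)) n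

  ∑<-periodic : ∀ a d f → (∀ t → f (d + t) ≡ f t) → ∑< (a * d) f ≡ a * ∑< d f
  ∑<-periodic zero    d f periodic = refl
  ∑<-periodic (suc a) d f periodic = trans (∑<-++ d (a * d) f) (cong (∑< d f +_)
    (trans (∑<-cong (a * d) {λ t → f (d + t)} {f} λ t _ → periodic t) (∑<-periodic a d f periodic)))

  ∑<-1 : ∀ n → ∑< n (λ _ → 1) ≡ n
  ∑<-1 zero    = refl
  ∑<-1 (suc n) = cong suc (∑<-1 n)

  coprime-respˡ : ∀ {k m n} → m ≡ n → Coprime m k → Coprime n k
  coprime-respˡ refl c = c

  coprime-∣ʳ : ∀ {k m n} → m ∣ n → Coprime k n → Coprime k m
  coprime-∣ʳ m∣n c (d∣k , d∣m) = c (d∣k , ∣-trans d∣m m∣n)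

  coprime-*ʳ : ∀ {k m n} → Coprime k m → Coprime k n → Coprime k (m * n)
  coprime-*ʳ cm cn (d∣k , d∣mn) =
    cn (d∣k , Coprime.coprime-divisor (λ (e∣d , e∣m) → cm (∣-trans e∣d d∣k , e∣m)) d∣mn)

  coprime-^ʳ : ∀ {k m} a → Coprime k m → Coprime k (m ^ a)
  coprime-^ʳ zero    c = Coprime.sym (Coprime.1-coprimeTo _)
  coprime-^ʳ (suc a) c = coprime-*ʳ c (coprime-^ʳ a c)

  -- The successor turns the range 0, ..., n - 1 of a sum into the range 1, ..., n over which `φ`
  -- counts.
  coprimeIndicator : ℕ → ℕ → ℕ
  coprimeIndicator n t = indicator (coprime? (suc t) n)

  φ≡∑ : ∀ n → φ n ≡ ∑< n (coprimeIndicator n)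
  φ≡∑ n = length-filter-applyUpTo (λ k → coprime? k n) suc n

  coprime-+ˡ : ∀ {d k} → Coprime (d + k) d → Coprime k d
  coprime-+ˡ c (e∣k , e∣d) = c (∣m∣n⇒∣m+n e∣d e∣k , e∣d)

  coprimeIndicator-periodic : ∀ d t → coprimeIndicator d (d + t) ≡ coprimeIndicator d t
  coprimeIndicator-periodic d t = indicator-⇔
    (coprime? (suc (d + t)) d) (coprime? (suc t) d)
    (λ c → coprime-+ˡ (coprime-respˡ (sym (ℕ.+-suc d t)) c))
    (λ c → coprime-respˡ (ℕ.+-suc d t) (Coprime.coprime-+ c))

  -- The hypothesis makes coprimality to q d the same as coprimality to d. That condition has period
  -- d, and q full periods are counted.
  φ-* : ∀ q d → (∀ {k} → Coprime k d → Coprime k q) → φ (q * d) ≡ q * φ d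
  φ-* q d d⇒q = begin
    φ (q * d)                             ≡⟨ φ≡∑ (q * d) ⟩
    ∑< (q * d) (coprimeIndicator (q * d)) ≡⟨ ∑<-cong (q * d) {coprimeIndicator (q * d)} {coprimeIndicator d} (λ t _ → indicator-⇔
                                               (coprime? (suc t) (q * d)) (coprime? (suc t) d)
                                               (λ c → coprime-∣ʳ (n∣m*n q) c) (λ c → coprime-*ʳ (d⇒q c) c)) ⟩
    ∑< (q * d) (coprimeIndicator d)       ≡⟨ ∑<-periodic q d (coprimeIndicator d) (coprimeIndicator-periodic d) ⟩
    q * ∑< d (coprimeIndicator d)         ≡⟨ cong (q *_) (φ≡∑ d) ⟨
    q * φ d                               ∎
    where open ≡-Reasoning

  -- Of the numbers 1, ..., p only the last, p itself, fails to be coprime to p.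
  ∑<-prime : ∀ {r} → Prime (suc r) → ∑< (suc r) (coprimeIndicator (suc r)) ≡ r
  ∑<-prime {r} p-prime = trans (∑<-last r (coprimeIndicator (suc r))) (trans (cong₂ _+_
    (trans (∑<-cong r {coprimeIndicator (suc r)} {λ _ → 1} λ t t<r →
      indicator-yes (coprime? (suc t) (suc r)) (Coprime.sym (Coprime.prime⇒coprime p-prime (s≤s t<r)))) (∑<-1 r))
    (indicator-no (coprime? (suc r) (suc r)) p-not-coprime)) (ℕ.+-identityʳ r))
    where
    p-not-coprime : ¬ Coprime (suc r) (suc r)
    p-not-coprime c = nonTrivial⇒≢1 {{prime⇒nonTrivial p-prime}} (c (∣-refl , ∣-refl))

  φ-prime : ∀ {r} → Prime (suc r) → φ (suc r) ≡ r
  φ-prime {r} p-prime = trans (φ≡∑ (suc r)) (∑<-prime p-prime)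

  2∣n⊎2∣1+n : ∀ n → 2 ∣ n ⊎ 2 ∣ suc n
  2∣n⊎2∣1+n zero    = inj₁ (2 ∣0)
  2∣n⊎2∣1+n (suc n) with 2∣n⊎2∣1+n n
  ... | inj₁ 2∣n   = inj₂ (∣m∣n⇒∣m+n ∣-refl 2∣n)
  ... | inj₂ 2∣1+n = inj₁ 2∣1+n

  odd⇒2∣1+ : ∀ {n} → ¬ 2 ∣ n → 2 ∣ suc n
  odd⇒2∣1+ {n} odd with 2∣n⊎2∣1+n n
  ... | inj₁ even = contradiction even odd
  ... | inj₂ even = even

  odd+odd : ∀ {m n} → ¬ 2 ∣ m → ¬ 2 ∣ n → 2 ∣ m + n
  odd+odd {m} {n} m-odd n-odd = ∣m+n∣m⇒∣n
    (subst (2 ∣_) (cong suc (ℕ.+-suc m n)) (∣m∣n⇒∣m+n (odd⇒2∣1+ m-odd) (odd⇒2∣1+ n-odd))) ∣-refl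

  odd⇒coprime-2 : ∀ {n} → ¬ 2 ∣ n → Coprime n 2
  odd⇒coprime-2 odd (d∣n , d∣2) with irreducible[2] d∣2
  ... | inj₁ d≡1  = d≡1
  ... | inj₂ refl = contradiction d∣n odd

  coprime-2⇒odd : ∀ {n} → Coprime n 2 → ¬ 2 ∣ n
  coprime-2⇒odd c 2∣n with () ← c (2∣n , ∣-refl)

  -- Of k and p + k exactly one is odd, and both are coprime to p or neither is.
  φ[2p] : ∀ {r} → Prime (suc r) → ¬ 2 ∣ suc r → φ (2 * suc r) ≡ r
  φ[2p] {r} p-prime p-odd = begin
    φ (2 * p)                                         ≡⟨ φ≡∑ (2 * p) ⟩
    ∑< (2 * p) g                                      ≡⟨ ∑<-++ p (p + 0) g ⟩
    ∑< p g + ∑< (p + 0) (λ t → g (p + t))             ≡⟨ cong (λ m → ∑< p g + ∑< m (λ t → g (p + t))) (ℕ.+-identityʳ p) ⟩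
    ∑< p g + ∑< p (λ t → g (p + t))                   ≡⟨ ∑-distrib-+ {p} (λ i → g (toℕ i)) (λ i → g (p + toℕ i)) ⟨
    ∑< p (λ t → g t + g (p + t))                      ≡⟨ ∑<-cong p {λ t → g t + g (p + t)} {coprimeIndicator p} (λ t _ → pair t) ⟩
    ∑< p (coprimeIndicator p)                         ≡⟨ ∑<-prime p-prime ⟩
    r                                                 ∎
    where
    open ≡-Reasoning
    open import Algebra.Properties.CommutativeMonoid.Sum ℕ.+-0-commutativeMonoid using (∑-distrib-+)
    open import Data.Fin.Base using (toℕ)
    p = suc r
    g = coprimeIndicator (2 * p)

    p+1+t : ∀ t → p + suc t ≡ suc (p + t)
    p+1+t = ℕ.+-suc p

    pair : ∀ t → g t + g (p + t) ≡ coprimeIndicator p t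
    pair t with coprime? (suc t) p | 2 ∣? suc t
    ... | no ¬c | _ = trans (cong₂ _+_
          (indicator-no (coprime? (suc t) (2 * p)) λ c → ¬c (coprime-∣ʳ (n∣m*n 2) c))
          (indicator-no (coprime? (suc (p + t)) (2 * p)) λ c →
            ¬c (coprime-+ˡ (coprime-respˡ (sym (p+1+t t)) (coprime-∣ʳ (n∣m*n 2) c)))))
          (sym (indicator-no (coprime? (suc t) p) ¬c))
    ... | yes c | yes even = trans (cong₂ _+_
          (indicator-no (coprime? (suc t) (2 * p)) λ c → coprime-2⇒odd (coprime-∣ʳ (m∣m*n p) c) even)
          (indicator-yes (coprime? (suc (p + t)) (2 * p)) (coprime-*ʳ
            (odd⇒coprime-2 λ 2∣ → p-odd (∣m+n∣m⇒∣n (subst (2 ∣_) (trans (sym (p+1+t t)) (ℕ.+-comm p (suc t))) 2∣) even))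
            (coprime-respˡ (p+1+t t) (Coprime.coprime-+ c)))))
          (sym (indicator-yes (coprime? (suc t) p) c))
    ... | yes c | no odd = trans (cong₂ _+_
          (indicator-yes (coprime? (suc t) (2 * p)) (coprime-*ʳ (odd⇒coprime-2 odd) c))
          (indicator-no (coprime? (suc (p + t)) (2 * p)) λ c → coprime-2⇒odd (coprime-∣ʳ (m∣m*n p) c)
            (subst (2 ∣_) (p+1+t t) (odd+odd p-odd odd))))
          (sym (indicator-yes (coprime? (suc t) p) c))

  φ[p^1+k] : ∀ {r} k → Prime (suc r) → φ (suc r ^ suc k) ≡ r * suc r ^ k
  φ[p^1+k] {r} k p-prime = begin
    φ (p * p ^ k)   ≡⟨ cong φ (ℕ.*-comm p (p ^ k)) ⟩
    φ (p ^ k * p)   ≡⟨ φ-* (p ^ k) p (coprime-^ʳ k) ⟩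
    p ^ k * φ p     ≡⟨ cong (p ^ k *_) (φ-prime p-prime) ⟩
    p ^ k * r       ≡⟨ ℕ.*-comm (p ^ k) r ⟩
    r * p ^ k       ∎
    where
    open ≡-Reasoning
    p = suc r

  -- Splitting n as q times its radical 2 p makes `φ-*` applicable: a number coprime to 2 p is
  -- coprime to every power of 2 and of p.
  φ[2^1+k*p^1+ℓ] : ∀ {r} k ℓ → Prime (suc r) → ¬ 2 ∣ suc r →
                   φ (2 ^ suc k * suc r ^ suc ℓ) ≡ r * (2 ^ k * suc r ^ ℓ)
  φ[2^1+k*p^1+ℓ] {r} k ℓ p-prime p-odd = begin
    φ (2 * 2 ^ k * (p * p ^ ℓ))   ≡⟨ cong φ (regroup (2 ^ k) p (p ^ ℓ)) ⟩
    φ (q * (2 * p))               ≡⟨ φ-* q (2 * p) (λ c → coprime-*ʳ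
                                       (coprime-^ʳ k (coprime-∣ʳ (m∣m*n p) c)) (coprime-^ʳ ℓ (coprime-∣ʳ (n∣m*n 2) c))) ⟩
    q * φ (2 * p)                 ≡⟨ cong (q *_) (φ[2p] p-prime p-odd) ⟩
    q * r                         ≡⟨ ℕ.*-comm q r ⟩
    r * q                         ∎
    where
    open ≡-Reasoning
    p = suc r
    q = 2 ^ k * p ^ ℓ
    regroup : ∀ a b c → 2 * a * (b * c) ≡ a * c * (2 * b)
    regroup = solve-∀

-- Cauchy reals: ring laws, cancellation and square roots.

module Reals where

  open import Algebra.Bundles using (CommutativeRing)
  import Algebra.Consequences.Setoid as Consequences
  open import Data.Nat.Base as ℕ using (ℕ; suc)
  import Data.Nat.Properties as ℕ
  open import Data.Integer.Base using (+_)
  open import Data.Product.Base using (_×_; _,_; proj₁; proj₂)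
  open import Data.Rational.Base as ℚ using (ℚ; 0ℚ; 1ℚ; ½; _+_; _*_; -_; _-_; _≤_; _<_; _/_; ∣_∣)
  import Data.Rational.Properties as ℚ
  open import Data.Rational.Solver using (module +-*-Solver)
  open import Level using (0ℓ)
  open import Relation.Binary.PropositionalEquality using (_≡_; refl; sym; trans; cong; subst; subst₂)
  open import Relation.Binary.Bundles using (Setoid)
  open import Relation.Binary.Structures using (IsEquivalence)
  open import Relation.Nullary using (¬_; yes; no; contradiction)

  -- The operations act termwise on representatives, so the ring laws of the reals reduce to those
  -- of the rationals.
  pointwise : ∀ {x y} → (∀ n → seq x n ≡ seq y n) → x ≈ᴿ y
  close (pointwise {x} {y} eq) ε 0<ε = 0 , λ n _ → subst (_< ε)
    (sym (cong ∣_∣ (trans (cong (_- seq y n) (eq n)) (ℚ.+-inverseʳ (seq y n))))) 0<ε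

  ≈ᴿ-refl : ∀ {x} → x ≈ᴿ x
  ≈ᴿ-refl = pointwise λ _ → refl

  ≈ᴿ-sym : ∀ {x y} → x ≈ᴿ y → y ≈ᴿ x
  close (≈ᴿ-sym {x} {y} x≈y) ε 0<ε =
    let N , h = close x≈y ε 0<ε
    in N , λ n N≤n → subst (_< ε) (∣p-q∣≡∣q-p∣ (seq x n) (seq y n)) (h n N≤n)

  ∣+∣<half+half : ∀ p q {ε} → ∣ p ∣ < ½ * ε → ∣ q ∣ < ½ * ε → ∣ p + q ∣ < ε
  ∣+∣<half+half p q {ε} hp hq =
    ℚ.≤-<-trans (ℚ.∣p+q∣≤∣p∣+∣q∣ p q) (subst (∣ p ∣ + ∣ q ∣ <_) (half+half ε) (ℚ.+-mono-< hp hq))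

  ≈ᴿ-trans : ∀ {x y z} → x ≈ᴿ y → y ≈ᴿ z → x ≈ᴿ z
  close (≈ᴿ-trans {x} {y} {z} x≈y y≈z) ε 0<ε =
    let N₁ , h₁ = close x≈y (½ * ε) (half-pos 0<ε)
        N₂ , h₂ = close y≈z (½ * ε) (half-pos 0<ε)
    in N₁ ℕ.⊔ N₂ , λ n N≤n → subst (λ t → ∣ t ∣ < ε)
         (solve 3 (λ a b c → (a :- b) :+ (b :- c) := a :- c) refl (seq x n) (seq y n) (seq z n))
         (∣+∣<half+half (seq x n - seq y n) (seq y n - seq z n)
           (h₁ n (ℕ.m⊔n≤o⇒m≤o N₁ N₂ N≤n)) (h₂ n (ℕ.m⊔n≤o⇒n≤o N₁ N₂ N≤n)))
    where open +-*-Solver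

  +ᴿ-cong : ∀ {x x′ y y′} → x ≈ᴿ x′ → y ≈ᴿ y′ → x +ᴿ y ≈ᴿ x′ +ᴿ y′
  close (+ᴿ-cong {x} {x′} {y} {y′} x≈ y≈) ε 0<ε =
    let N₁ , h₁ = close x≈ (½ * ε) (half-pos 0<ε)
        N₂ , h₂ = close y≈ (½ * ε) (half-pos 0<ε)
    in N₁ ℕ.⊔ N₂ , λ n N≤n → subst (λ t → ∣ t ∣ < ε)
         (solve 4 (λ a a′ b b′ → (a :- a′) :+ (b :- b′) := (a :+ b) :- (a′ :+ b′)) refl
           (seq x n) (seq x′ n) (seq y n) (seq y′ n))
         (∣+∣<half+half (seq x n - seq x′ n) (seq y n - seq y′ n) (h₁ n (ℕ.m⊔n≤o⇒m≤o N₁ N₂ N≤n)) (h₂ n (ℕ.m⊔n≤o⇒n≤o N₁ N₂ N≤n)))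
    where open +-*-Solver

  -ᴿ-cong : ∀ {x y} → x ≈ᴿ y → -ᴿ x ≈ᴿ -ᴿ y
  close (-ᴿ-cong {x} {y} x≈y) ε 0<ε =
    let N , h = close x≈y ε 0<ε
    in N , λ n N≤n → subst (_< ε)
         (trans (sym (ℚ.∣-p∣≡∣p∣ (seq x n - seq y n)))
           (cong ∣_∣ (solve 2 (λ a b → :- (a :- b) := (:- a) :- (:- b)) refl (seq x n) (seq y n))))
         (h n N≤n)
    where open +-*-Solver

  *ᴿ-congˡ : ∀ x {y y′} → y ≈ᴿ y′ → x *ᴿ y ≈ᴿ x *ᴿ y′
  close (*ᴿ-congˡ x {y} {y′} y≈) ε 0<ε =
    let B , 0<B , N₁ , x≤B = eventually-bounded (cauchy x)
        N₂ , h = close y≈ _ (scaled-pos 0<B 0<ε)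
    in N₁ ℕ.⊔ N₂ , λ n N≤n → subst (λ t → ∣ t ∣ < ε)
         (solve 3 (λ a b c → a :* (b :- c) := a :* b :- a :* c) refl (seq x n) (seq y n) (seq y′ n))
         (*-small {seq x n} {seq y n - seq y′ n} 0<B (x≤B n (ℕ.m⊔n≤o⇒m≤o N₁ N₂ N≤n)) (h n (ℕ.m⊔n≤o⇒n≤o N₁ N₂ N≤n)))
    where open +-*-Solver

  *ᴿ-comm : ∀ x y → x *ᴿ y ≈ᴿ y *ᴿ x
  *ᴿ-comm x y = pointwise {x *ᴿ y} {y *ᴿ x} λ n → ℚ.*-comm (seq x n) (seq y n)

  *ᴿ-cong : ∀ {x x′ y y′} → x ≈ᴿ x′ → y ≈ᴿ y′ → x *ᴿ y ≈ᴿ x′ *ᴿ y′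
  *ᴿ-cong {x} {x′} {y} {y′} x≈ y≈ =
    ≈ᴿ-trans {x *ᴿ y} {x *ᴿ y′} {x′ *ᴿ y′} (*ᴿ-congˡ x {y} {y′} y≈)
      (≈ᴿ-trans {x *ᴿ y′} {y′ *ᴿ x} {x′ *ᴿ y′} (*ᴿ-comm x y′)
        (≈ᴿ-trans {y′ *ᴿ x} {y′ *ᴿ x′} {x′ *ᴿ y′} (*ᴿ-congˡ y′ {x} {x′} x≈) (*ᴿ-comm y′ x′)))

  -- The ring operations are opaque: comparing transparent ones by conversion would unfold Cauchy moduli.
  infixl 6 _⊕_
  infixl 7 _⊗_
  infix  8 ⊖_

  opaque
    _⊕_ _⊗_ : ℝ → ℝ → ℝ
    x ⊕ y = x +ᴿ y
    x ⊗ y = x *ᴿ y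

    ⊖_ : ℝ → ℝ
    ⊖ x = -ᴿ x

    *ᴿ≈⊗ : ∀ x y → x *ᴿ y ≈ᴿ x ⊗ y
    *ᴿ≈⊗ x y = ≈ᴿ-refl

    ⊕-cong : ∀ {x x′ y y′} → x ≈ᴿ x′ → y ≈ᴿ y′ → x ⊕ y ≈ᴿ x′ ⊕ y′
    ⊕-cong {x} {x′} {y} {y′} = +ᴿ-cong {x} {x′} {y} {y′}

    ⊗-cong : ∀ {x x′ y y′} → x ≈ᴿ x′ → y ≈ᴿ y′ → x ⊗ y ≈ᴿ x′ ⊗ y′
    ⊗-cong {x} {x′} {y} {y′} = *ᴿ-cong {x} {x′} {y} {y′}

    ⊖-cong : ∀ {x y} → x ≈ᴿ y → ⊖ x ≈ᴿ ⊖ y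
    ⊖-cong {x} {y} = -ᴿ-cong {x} {y}

    ⊕-assoc : ∀ x y z → (x ⊕ y) ⊕ z ≈ᴿ x ⊕ (y ⊕ z)
    ⊕-assoc x y z = pointwise λ n → ℚ.+-assoc (seq x n) (seq y n) (seq z n)

    ⊗-assoc : ∀ x y z → (x ⊗ y) ⊗ z ≈ᴿ x ⊗ (y ⊗ z)
    ⊗-assoc x y z = pointwise λ n → ℚ.*-assoc (seq x n) (seq y n) (seq z n)

    ⊕-comm : ∀ x y → x ⊕ y ≈ᴿ y ⊕ x
    ⊕-comm x y = pointwise λ n → ℚ.+-comm (seq x n) (seq y n)

    ⊗-comm : ∀ x y → x ⊗ y ≈ᴿ y ⊗ x
    ⊗-comm x y = pointwise λ n → ℚ.*-comm (seq x n) (seq y n)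

    ⊕-identityˡ : ∀ x → fromℚ 0ℚ ⊕ x ≈ᴿ x
    ⊕-identityˡ x = pointwise λ n → ℚ.+-identityˡ (seq x n)

    ⊗-identityˡ : ∀ x → fromℚ 1ℚ ⊗ x ≈ᴿ x
    ⊗-identityˡ x = pointwise λ n → ℚ.*-identityˡ (seq x n)

    ⊖-inverseˡ : ∀ x → ⊖ x ⊕ x ≈ᴿ fromℚ 0ℚ
    ⊖-inverseˡ x = pointwise λ n → ℚ.+-inverseˡ (seq x n)

    ⊗-distribˡ-⊕ : ∀ x y z → x ⊗ (y ⊕ z) ≈ᴿ x ⊗ y ⊕ x ⊗ z
    ⊗-distribˡ-⊕ x y z = pointwise λ n → ℚ.*-distribˡ-+ (seq x n) (seq y n) (seq z n)

  commutativeRing : ∀ {A : Set} {_≈_ : A → A → Set} {_+_ _*_ : A → A → A} {neg : A → A} {0# 1# : A} →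
    IsEquivalence _≈_ →
    (∀ {x x′ y y′} → x ≈ x′ → y ≈ y′ → (x + y) ≈ (x′ + y′)) →
    (∀ {x x′ y y′} → x ≈ x′ → y ≈ y′ → (x * y) ≈ (x′ * y′)) →
    (∀ {x y} → x ≈ y → neg x ≈ neg y) →
    (∀ x y z → ((x + y) + z) ≈ (x + (y + z))) → (∀ x y z → ((x * y) * z) ≈ (x * (y * z))) →
    (∀ x y → (x + y) ≈ (y + x)) → (∀ x y → (x * y) ≈ (y * x)) →
    (∀ x → (0# + x) ≈ x) → (∀ x → (1# * x) ≈ x) → (∀ x → (neg x + x) ≈ 0#) →
    (∀ x y z → (x * (y + z)) ≈ ((x * y) + (x * z))) →
    CommutativeRing 0ℓ 0ℓ
  commutativeRing {A} {_≈_} {_+_} {_*_} {neg} {0#} {1#}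
      equiv +-cong *-cong neg-cong +-assoc *-assoc +-comm *-comm +-identityˡ *-identityˡ inverseˡ distribˡ = record
    { Carrier = A ; _≈_ = _≈_ ; _+_ = _+_ ; _*_ = _*_ ; -_ = neg ; 0# = 0# ; 1# = 1#
    ; isCommutativeRing = record
      { isRing = record
        { +-isAbelianGroup = record
          { isGroup = record
            { isMonoid = record
              { isSemigroup = record
                { isMagma = record { isEquivalence = equiv ; ∙-cong = +-cong }
                ; assoc = +-assoc }
              ; identity = comm∧idˡ⇒id +-comm +-identityˡ }
            ; inverse = comm∧invˡ⇒inv +-comm inverseˡ
            ; ⁻¹-cong = neg-cong }
          ; comm = +-comm }
        ; *-cong = *-cong
        ; *-assoc = *-assoc
        ; *-identity = comm∧idˡ⇒id *-comm *-identityˡ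
        ; distrib = comm∧distrˡ⇒distr +-cong *-comm distribˡ }
      ; *-comm = *-comm } }
    where
    setoid : Setoid 0ℓ 0ℓ
    setoid = record { isEquivalence = equiv }
    open Consequences setoid

  ℝ-commutativeRing : CommutativeRing 0ℓ 0ℓ
  ℝ-commutativeRing = commutativeRing
    (record { refl = ≈ᴿ-refl ; sym = ≈ᴿ-sym ; trans = ≈ᴿ-trans })
    ⊕-cong ⊗-cong ⊖-cong ⊕-assoc ⊗-assoc ⊕-comm ⊗-comm ⊕-identityˡ ⊗-identityˡ ⊖-inverseˡ ⊗-distribˡ-⊕

  -- The inequalities are asked of the representatives at every index, which is the form in which
  -- the bounds on `sqrtApprox` are available.
  squeeze : ∀ {x y z} → (∀ n → seq x n ≤ seq y n) → (∀ n → seq y n ≤ seq z n) →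
            x ≈ᴿ z → x ≈ᴿ y
  close (squeeze {x} {y} {z} x≤y y≤z x≈z) ε 0<ε =
    let N , h = close x≈z ε 0<ε
    in N , λ n N≤n → p<q+ε⇒∣p-q∣<ε
         (ℚ.≤-<-trans (x≤y n) (subst (_< seq y n + ε) (ℚ.+-identityʳ (seq y n)) (ℚ.+-monoʳ-< (seq y n) 0<ε)))
         (ℚ.≤-<-trans (y≤z n) (∣p-q∣<ε⇒p<q+ε
           (subst (_< ε) (∣p-q∣≡∣q-p∣ (seq x n) (seq z n)) (h n N≤n))))

  -- Deciding |y_N| < ε/2 at one sufficiently late index N replaces the (unavailable) decision y ≈ 0.
  ℝ-cancel : ∀ x y → x *ᴿ y ≈ᴿ fromℚ 0ℚ → ¬ (x ≈ᴿ fromℚ 0ℚ) → y ≈ᴿ fromℚ 0ℚ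
  close (ℝ-cancel x y xy≈0 x≉0) ε 0<ε = decide (modulus (cauchy y) (½ * h) 0<g)
    where
    open +-*-Solver
    h = ½ * ε
    g = ½ * h
    0<h = half-pos 0<ε
    0<g = half-pos 0<h
    p-0≡p : ∀ q → q - 0ℚ ≡ q
    p-0≡p = solve 1 (λ q → q :- con 0ℚ := q) refl

    g≤h : g ≤ h
    g≤h = subst₂ _≤_ (ℚ.+-identityʳ g) (half+half h) (ℚ.+-monoʳ-≤ g (ℚ.<⇒≤ 0<g))

    decide : _ → _
    decide (N , near) with ∣ seq y N ∣ ℚ.<? h
    ... | yes y<h = N , λ n N≤n → subst (λ t → ∣ t ∣ < ε)
          (solve 2 (λ a b → (a :- b) :+ b := a :- con 0ℚ) refl (seq y n) (seq y N))
          (∣+∣<half+half (seq y n - seq y N) (seq y N) {ε} (ℚ.<-≤-trans (near n N N≤n ℕ.≤-refl) g≤h) y<h)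
    -- From ∣y_N∣ ≥ h and a variation below g = h/2 follows ∣y_n∣ ≥ g for all n ≥ N. Then ∣x_n y_n∣
    -- < δ g forces ∣x_n∣ < δ, so x would be zero.
    ... | no  y≮h = contradiction (mk≈ᴿ λ δ 0<δ →
          let M , small = close xy≈0 (δ * g) (subst (_< δ * g) (ℚ.*-zeroʳ δ) (ℚ.*-monoʳ-<-pos δ {{ℚ.positive 0<δ}} 0<g))
          in N ℕ.⊔ M , λ n NM≤n →
            let N≤n = ℕ.m⊔n≤o⇒m≤o N M NM≤n
                g≤y = ℚ.≮⇒≥ λ y<g → y≮h (ℚ.≤-<-trans
                        (subst (λ t → ∣ t ∣ ≤ ∣ seq y N - seq y n ∣ + ∣ seq y n ∣)
                          (solve 2 (λ a b → (a :- b) :+ b := a) refl (seq y N) (seq y n))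
                          (ℚ.∣p+q∣≤∣p∣+∣q∣ (seq y N - seq y n) (seq y n)))
                        (subst (_ <_) (half+half h) (ℚ.+-mono-< (near N n ℕ.≤-refl N≤n) y<g)))
            in subst (λ t → ∣ t ∣ < δ) (sym (p-0≡p (seq x n)))
                 (ℚ.*-cancelʳ-<-nonNeg g {{ℚ.nonNegative (ℚ.<⇒≤ 0<g)}}
                   (ℚ.≤-<-trans (ℚ.*-monoˡ-≤-nonNeg ∣ seq x n ∣ {{ℚ.∣-∣-nonNeg (seq x n)}} g≤y)
                     (subst (_< δ * g) (trans (cong ∣_∣ (p-0≡p (seq x n * seq y n))) (ℚ.∣p*q∣≡∣p∣*∣q∣ (seq x n) (seq y n)))
                       (small n (ℕ.m⊔n≤o⇒n≤o N M NM≤n)))))) x≉0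

  square≈0⇒≈0 : ∀ {x} → x *ᴿ x ≈ᴿ fromℚ 0ℚ → x ≈ᴿ fromℚ 0ℚ
  close (square≈0⇒≈0 {x} xx≈0) ε 0<ε =
    let N , h = close xx≈0 (ε * ε) (ℚ.positive⁻¹ (ε * ε) {{ℚ.pos*pos⇒pos ε {{ℚ.positive 0<ε}} ε {{ℚ.positive 0<ε}}}})
    in N , λ n N≤n → square-cancel-< (ℚ.<⇒≤ 0<ε) (subst (_< ε * ε)
         (trans (cong ∣_∣ (solve 1 (λ a → a :* a :- con 0ℚ := (a :- con 0ℚ) :* (a :- con 0ℚ)) refl (seq x n)))
                (ℚ.∣p*q∣≡∣p∣*∣q∣ (seq x n - 0ℚ) (seq x n - 0ℚ)))
         (h n N≤n))
    where open +-*-Solver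

  -- A representative of zero whose terms are the grid widths of `sqrtApprox`: adding it turns the
  -- lower approximation of a root into an upper one, index by index.
  1/suc : ℝ
  1/suc = mkℝ (λ n → + 1 / suc n) (mkCauchy λ ε 0<ε →
    let N , h = archimedean (½ * ε) (half-pos 0<ε)
        bound = λ m n N≤m → ℚ.≤-<-trans (h m N≤m) (half<sum ε 0<ε (1/suc-pos n))
    in N , λ m n N≤m N≤n → p<q+ε⇒∣p-q∣<ε (bound m n N≤m) (bound n m N≤n))
    where
    half<sum : ∀ ε {u} → 0ℚ < ε → 0ℚ < u → ½ * ε < u + ε
    half<sum ε {u} 0<ε 0<u = subst₂ _<_ (ℚ.+-identityˡ (½ * ε)) (cong (λ t → u + t) (half+half ε))
      (ℚ.+-mono-<-≤ 0<u (subst (_≤ ½ * ε + ½ * ε) (ℚ.+-identityʳ (½ * ε)) (ℚ.+-monoʳ-≤ (½ * ε) (ℚ.<⇒≤ (half-pos 0<ε)))))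

  1/suc≈0 : fromℚ 0ℚ ≈ᴿ 1/suc
  close 1/suc≈0 ε 0<ε =
    let N , h = archimedean (½ * ε) (half-pos 0<ε)
    in N , λ n N≤n → p<q+ε⇒∣p-q∣<ε
         (ℚ.<-trans 0<ε (subst (_< + 1 / suc n + ε) (ℚ.+-identityˡ ε) (ℚ.+-monoˡ-< ε (1/suc-pos n))))
         (subst₂ _<_ (ℚ.+-identityʳ (+ 1 / suc n)) (trans (half+half ε) (sym (ℚ.+-identityˡ ε)))
           (ℚ.+-mono-≤-< (h n N≤n) (half-pos 0<ε)))

  -- The square root is Hölder continuous of exponent 1/2: arguments within h² of each other have
  -- approximations within 2 h = ε, as soon as the grid width is at most h.
  √-cong : ∀ {x y} → x ≈ᴿ y → √ x ≈ᴿ √ y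
  close (√-cong {x} {y} x≈y) ε 0<ε =
    let h = ½ * ε
        0<h = half-pos 0<ε
        N₁ , h₁ = close x≈y (h * h) (ℚ.positive⁻¹ (h * h) {{ℚ.pos*pos⇒pos h {{ℚ.positive 0<h}} h {{ℚ.positive 0<h}}}})
        N₂ , h₂ = archimedean h 0<h
    in N₁ ℕ.⊔ N₂ , λ n N≤n →
      let near = h₁ n (ℕ.m⊔n≤o⇒m≤o N₁ N₂ N≤n)
          u≤h = h₂ n (ℕ.m⊔n≤o⇒n≤o N₁ N₂ N≤n)
          within = λ p q p<q → subst (λ e → sqrtApprox n p < sqrtApprox n q + e) (half+half ε)
                     (sqrt-close n n p q h 0<h u≤h p<q)
      in p<q+ε⇒∣p-q∣<ε
           (within (seq x n) (seq y n) (∣p-q∣<ε⇒p<q+ε near))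
           (within (seq y n) (seq x n) (∣p-q∣<ε⇒p<q+ε
             (subst (_< h * h) (∣p-q∣≡∣q-p∣ (seq x n) (seq y n)) near)))

  -- A condition on every term of the representative and not only on the limit. It removes the
  -- truncation at 0 inside `sqrtApprox`, and sums of squares satisfy it.
  NonNegᴿ : ℝ → Set
  NonNegᴿ x = ∀ n → 0ℚ ≤ seq x n

  sqrtApprox-nonNeg-bounds : ∀ n {q} → 0ℚ ≤ q → let s = sqrtApprox n q ; u = + 1 / suc n in
    s * s ≤ q × q < (s + u) * (s + u)
  sqrtApprox-nonNeg-bounds n {q} 0≤q =
    subst (λ t → s * s ≤ t × t < (s + u) * (s + u)) (ℚ.p≤q⇒p⊔q≡q 0≤q) (sqrtApprox-bounds n q)
    where
    s = sqrtApprox n q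
    u = + 1 / suc n

  x+1/suc≈x : ∀ x → x ≈ᴿ x +ᴿ 1/suc
  x+1/suc≈x x = ≈ᴿ-trans {x} {x +ᴿ fromℚ 0ℚ} {x +ᴿ 1/suc}
    (pointwise {x} {x +ᴿ fromℚ 0ℚ} λ n → sym (ℚ.+-identityʳ (seq x n)))
    (+ᴿ-cong {x} {x} {fromℚ 0ℚ} {1/suc} ≈ᴿ-refl 1/suc≈0)

  -- At index n the term of x lies between s² and (s + 1/(n+1))², where s is the approximate root;
  -- both bounds represent the same real.
  √x*√x≈x : ∀ x → NonNegᴿ x → √ x *ᴿ √ x ≈ᴿ x
  √x*√x≈x x 0≤x = squeeze {√ x *ᴿ √ x} {x} {(√ x +ᴿ 1/suc) *ᴿ (√ x +ᴿ 1/suc)}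
    (λ n → proj₁ (sqrtApprox-nonNeg-bounds n (0≤x n)))
    (λ n → ℚ.<⇒≤ (proj₂ (sqrtApprox-nonNeg-bounds n (0≤x n))))
    (*ᴿ-cong {√ x} {√ x +ᴿ 1/suc} {√ x} {√ x +ᴿ 1/suc} (x+1/suc≈x (√ x)) (x+1/suc≈x (√ x)))

  √[x*x]≈x : ∀ x → NonNegᴿ x → √ (x *ᴿ x) ≈ᴿ x
  √[x*x]≈x x 0≤x = squeeze {√ (x *ᴿ x)} {x} {√ (x *ᴿ x) +ᴿ 1/suc}
    (λ n → ℚ.≮⇒≥ λ x<s → ℚ.<-irrefl refl (ℚ.<-≤-trans (square-mono-< (0≤x n) x<s) (proj₁ (bounds n))))
    (λ n → ℚ.<⇒≤ (square-cancel-<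
      (ℚ.≤-trans (0≤sqrtApprox n (seq x n * seq x n)) (subst (_≤ seq (√ (x *ᴿ x) +ᴿ 1/suc) n)
        (ℚ.+-identityʳ (sqrtApprox n (seq x n * seq x n)))
        (ℚ.+-monoʳ-≤ (sqrtApprox n (seq x n * seq x n)) (ℚ.<⇒≤ (1/suc-pos n)))))
      (proj₂ (bounds n))))
    (x+1/suc≈x (√ (x *ᴿ x)))
    where
    square-mono-< : ∀ {a b} → 0ℚ ≤ a → a < b → a * a < b * b
    square-mono-< {a} {b} 0≤a a<b = ℚ.≤-<-trans
      (ℚ.*-monoˡ-≤-nonNeg a {{ℚ.nonNegative 0≤a}} (ℚ.<⇒≤ a<b))
      (ℚ.*-monoˡ-<-pos b {{ℚ.positive (ℚ.≤-<-trans 0≤a a<b)}} a<b)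

    bounds = λ n → sqrtApprox-nonNeg-bounds n {seq x n * seq x n} (subst (_≤ seq x n * seq x n) (ℚ.*-zeroʳ (seq x n))
      (ℚ.*-monoˡ-≤-nonNeg (seq x n) {{ℚ.nonNegative (0≤x n)}} (0≤x n)))

-- Complex numbers: ring laws, squared norm and cancellation.

module Complexes where

  open CommutativeAlgebra
  open Reals
  open import Algebra.Bundles using (CommutativeRing)
  open import Data.Nat.Base using (ℕ)
  import Data.Nat.Properties as ℕ
  open import Data.Product.Base using (_,_)
  open import Data.Rational.Base as ℚ using (0ℚ; 1ℚ; _≤_)
  import Data.Rational.Properties as ℚ
  open import Data.Rational.Solver using (module +-*-Solver)
  open import Data.Sum.Base using (inj₁; inj₂)
  open import Level using (0ℓ)
  open import Relation.Binary.PropositionalEquality as ≡ using (refl; subst)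
  open import Relation.Nullary using (¬_)

  infixl 6 _⊞_
  infixl 7 _⊠_
  infix  8 ⊟_

  ≈ᶜ-refl : ∀ {z} → z ≈ᶜ z
  ≈ᶜ-refl = mk≈ᶜ ≈ᴿ-refl ≈ᴿ-refl

  ≈ᶜ-sym : ∀ {z w} → z ≈ᶜ w → w ≈ᶜ z
  ≈ᶜ-sym (mk≈ᶜ p q) = mk≈ᶜ (≈ᴿ-sym p) (≈ᴿ-sym q)

  ≈ᶜ-trans : ∀ {z w v} → z ≈ᶜ w → w ≈ᶜ v → z ≈ᶜ v
  ≈ᶜ-trans (mk≈ᶜ p q) (mk≈ᶜ p′ q′) = mk≈ᶜ (≈ᴿ-trans p p′) (≈ᴿ-trans q q′)

  normSq : ℂ → ℝ
  normSq z = re z ⊗ re z ⊕ im z ⊗ im z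

  ofReal : ℝ → ℂ
  ofReal x = x +i fromℚ 0ℚ

  opaque
    _⊞_ _⊠_ : ℂ → ℂ → ℂ
    z ⊞ w = (re z ⊕ re w) +i (im z ⊕ im w)
    z ⊠ w = (re z ⊗ re w ⊕ ⊖ (im z ⊗ im w)) +i (re z ⊗ im w ⊕ im z ⊗ re w)

    ⊟_ : ℂ → ℂ
    ⊟ z = (⊖ re z) +i (⊖ im z)

    ⊞-cong : ∀ {z z′ w w′} → z ≈ᶜ z′ → w ≈ᶜ w′ → z ⊞ w ≈ᶜ z′ ⊞ w′
    ⊞-cong {z} {z′} {w} {w′} (mk≈ᶜ p q) (mk≈ᶜ p′ q′) = mk≈ᶜ
      (⊕-cong {re z} {re z′} {re w} {re w′} p p′) (⊕-cong {im z} {im z′} {im w} {im w′} q q′)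

    ⊠-cong : ∀ {z z′ w w′} → z ≈ᶜ z′ → w ≈ᶜ w′ → z ⊠ w ≈ᶜ z′ ⊠ w′
    ⊠-cong {a +i b} {a′ +i b′} {c +i d} {c′ +i d′} (mk≈ᶜ p q) (mk≈ᶜ p′ q′) = mk≈ᶜ
      (⊕-cong {a ⊗ c} {a′ ⊗ c′} {⊖ (b ⊗ d)} {⊖ (b′ ⊗ d′)}
        (⊗-cong {a} {a′} {c} {c′} p p′) (⊖-cong {b ⊗ d} {b′ ⊗ d′} (⊗-cong {b} {b′} {d} {d′} q q′)))
      (⊕-cong {a ⊗ d} {a′ ⊗ d′} {b ⊗ c} {b′ ⊗ c′}
        (⊗-cong {a} {a′} {d} {d′} p q′) (⊗-cong {b} {b′} {c} {c′} q p′))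

    ⊟-cong : ∀ {z w} → z ≈ᶜ w → ⊟ z ≈ᶜ ⊟ w
    ⊟-cong {z} {w} (mk≈ᶜ p q) = mk≈ᶜ (⊖-cong {re z} {re w} p) (⊖-cong {im z} {im w} q)

    ⊞-assoc : ∀ z w v → (z ⊞ w) ⊞ v ≈ᶜ z ⊞ (w ⊞ v)
    ⊞-assoc z w v = mk≈ᶜ (⊕-assoc (re z) (re w) (re v)) (⊕-assoc (im z) (im w) (im v))

    ⊞-comm : ∀ z w → z ⊞ w ≈ᶜ w ⊞ z
    ⊞-comm z w = mk≈ᶜ (⊕-comm (re z) (re w)) (⊕-comm (im z) (im w))

    ⊞-identityˡ : ∀ z → 0ᶜ ⊞ z ≈ᶜ z
    ⊞-identityˡ z = mk≈ᶜ (⊕-identityˡ (re z)) (⊕-identityˡ (im z))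

    ⊟-inverseˡ : ∀ z → ⊟ z ⊞ z ≈ᶜ 0ᶜ
    ⊟-inverseˡ z = mk≈ᶜ (⊖-inverseˡ (re z)) (⊖-inverseˡ (im z))

    re-⊞ : ∀ z w → re (z ⊞ w) ≈ᴿ re z ⊕ re w
    re-⊞ z w = ≈ᴿ-refl

  normSq-cong : ∀ {z w} → z ≈ᶜ w → normSq z ≈ᴿ normSq w
  normSq-cong {a +i b} {c +i d} (mk≈ᶜ p q) =
    ⊕-cong {a ⊗ a} {c ⊗ c} {b ⊗ b} {d ⊗ d} (⊗-cong {a} {c} {a} {c} p p) (⊗-cong {b} {d} {b} {d} q q)

  open +-*-Solver

  opaque
    unfolding _⊕_ _⊞_

    *ᶜ≈⊠ : ∀ z w → z *ᶜ w ≈ᶜ z ⊠ w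
    *ᶜ≈⊠ z w = mk≈ᶜ (pointwise λ n → refl) (pointwise λ n → refl)

    ⊠-assoc : ∀ z w v → (z ⊠ w) ⊠ v ≈ᶜ z ⊠ (w ⊠ v)
    ⊠-assoc (a +i b) (c +i d) (e +i f) = mk≈ᶜ
      (pointwise λ n → solve 6 (λ a b c d e f →
        (a :* c :+ (:- (b :* d))) :* e :+ (:- ((a :* d :+ b :* c) :* f))
          := a :* (c :* e :+ (:- (d :* f))) :+ (:- (b :* (c :* f :+ d :* e))))
        refl (seq a n) (seq b n) (seq c n) (seq d n) (seq e n) (seq f n))
      (pointwise λ n → solve 6 (λ a b c d e f →
        (a :* c :+ (:- (b :* d))) :* f :+ (a :* d :+ b :* c) :* e
          := a :* (c :* f :+ d :* e) :+ b :* (c :* e :+ (:- (d :* f))))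
        refl (seq a n) (seq b n) (seq c n) (seq d n) (seq e n) (seq f n))

    ⊠-comm : ∀ z w → z ⊠ w ≈ᶜ w ⊠ z
    ⊠-comm (a +i b) (c +i d) = mk≈ᶜ
      (pointwise λ n → solve 4 (λ a b c d → a :* c :+ (:- (b :* d)) := c :* a :+ (:- (d :* b)))
        refl (seq a n) (seq b n) (seq c n) (seq d n))
      (pointwise λ n → solve 4 (λ a b c d → a :* d :+ b :* c := c :* b :+ d :* a)
        refl (seq a n) (seq b n) (seq c n) (seq d n))

    ⊠-identityˡ : ∀ z → 1ᶜ ⊠ z ≈ᶜ z
    ⊠-identityˡ (a +i b) = mk≈ᶜ
      (pointwise λ n → solve 2 (λ a b → con 1ℚ :* a :+ (:- (con 0ℚ :* b)) := a) refl (seq a n) (seq b n))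
      (pointwise λ n → solve 2 (λ a b → con 1ℚ :* b :+ con 0ℚ :* a := b) refl (seq a n) (seq b n))

    ⊠-distribˡ-⊞ : ∀ z w v → z ⊠ (w ⊞ v) ≈ᶜ z ⊠ w ⊞ z ⊠ v
    ⊠-distribˡ-⊞ (a +i b) (c +i d) (e +i f) = mk≈ᶜ
      (pointwise λ n → solve 6 (λ a b c d e f →
        a :* (c :+ e) :+ (:- (b :* (d :+ f)))
          := (a :* c :+ (:- (b :* d))) :+ (a :* e :+ (:- (b :* f))))
        refl (seq a n) (seq b n) (seq c n) (seq d n) (seq e n) (seq f n))
      (pointwise λ n → solve 6 (λ a b c d e f →
        a :* (d :+ f) :+ b :* (c :+ e) := (a :* d :+ b :* c) :+ (a :* f :+ b :* e))
        refl (seq a n) (seq b n) (seq c n) (seq d n) (seq e n) (seq f n))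

    ofReal-⊞ : ∀ x y → ofReal x ⊞ ofReal y ≈ᶜ ofReal (x ⊕ y)
    ofReal-⊞ x y = mk≈ᶜ (pointwise λ n → refl) (pointwise λ n → refl)

    ofReal-⊠ : ∀ x y → ofReal x ⊠ ofReal y ≈ᶜ ofReal (x ⊗ y)
    ofReal-⊠ x y = mk≈ᶜ
      (pointwise λ n → solve 2 (λ a b → a :* b :+ (:- (con 0ℚ :* con 0ℚ)) := a :* b) refl (seq x n) (seq y n))
      (pointwise λ n → solve 2 (λ a b → a :* con 0ℚ :+ con 0ℚ :* b := con 0ℚ) refl (seq x n) (seq y n))

    normSq-ofReal : ∀ x → normSq (ofReal x) ≈ᴿ x ⊗ x
    normSq-ofReal x = pointwise λ n → solve 1 (λ a → a :* a :+ con 0ℚ :* con 0ℚ := a :* a) refl (seq x n)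

    normSq-⊠ : ∀ z w → normSq (z ⊠ w) ≈ᴿ normSq z ⊗ normSq w
    normSq-⊠ (a +i b) (c +i d) = pointwise λ n → solve 4 (λ a b c d →
      (a :* c :+ (:- (b :* d))) :* (a :* c :+ (:- (b :* d))) :+ (a :* d :+ b :* c) :* (a :* d :+ b :* c)
        := (a :* a :+ b :* b) :* (c :* c :+ d :* d))
      refl (seq a n) (seq b n) (seq c n) (seq d n)

    normSq-1⊟ : ∀ z → normSq (1ᶜ ⊞ ⊟ z) ⊕ (re z ⊕ re z) ≈ᴿ fromℚ 1ℚ ⊕ normSq z
    normSq-1⊟ (a +i b) = pointwise λ n → solve 2 (λ a b →
      ((con 1ℚ :+ (:- a)) :* (con 1ℚ :+ (:- a)) :+ (con 0ℚ :+ (:- b)) :* (con 0ℚ :+ (:- b))) :+ (a :+ a)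
        := con 1ℚ :+ (a :* a :+ b :* b))
      refl (seq a n) (seq b n)

    nonNeg-⊕ : ∀ {x y} → NonNegᴿ x → NonNegᴿ y → NonNegᴿ (x ⊕ y)
    nonNeg-⊕ {x} {y} 0≤x 0≤y n = subst (_≤ seq x n ℚ.+ seq y n) (ℚ.+-identityˡ 0ℚ) (ℚ.+-mono-≤ (0≤x n) (0≤y n))

    nonNeg-⊗ : ∀ {x y} → NonNegᴿ x → NonNegᴿ y → NonNegᴿ (x ⊗ y)
    nonNeg-⊗ {x} {y} 0≤x 0≤y n = ℚ.nonNegative⁻¹ (seq x n ℚ.* seq y n)
      {{ℚ.nonNeg*nonNeg⇒nonNeg (seq x n) {{ℚ.nonNegative (0≤x n)}} (seq y n) {{ℚ.nonNegative (0≤y n)}}}}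

    nonNeg-square : ∀ x → NonNegᴿ (x ⊗ x)
    nonNeg-square x n with ℚ.≤-total 0ℚ (seq x n)
    ... | inj₁ 0≤x = ℚ.nonNegative⁻¹ (seq x n ℚ.* seq x n)
          {{ℚ.nonNeg*nonNeg⇒nonNeg (seq x n) {{ℚ.nonNegative 0≤x}} (seq x n) {{ℚ.nonNegative 0≤x}}}}
    ... | inj₂ x≤0 = ℚ.nonNegative⁻¹ (seq x n ℚ.* seq x n)
          {{ℚ.nonPos*nonPos⇒nonPos (seq x n) {{ℚ.nonPositive x≤0}} (seq x n) {{ℚ.nonPositive x≤0}}}}

    1⊕nonNeg≉0 : ∀ {x} → NonNegᴿ x → ¬ (fromℚ 1ℚ ⊕ x ≈ᴿ fromℚ 0ℚ)
    1⊕nonNeg≉0 {x} 0≤x 1+x≈0 =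
      let N , h = close 1+x≈0 1ℚ (ℚ.positive⁻¹ 1ℚ)
          1+x<1 = ∣p-q∣<ε⇒p<q+ε {1ℚ ℚ.+ seq x N} {0ℚ} {1ℚ} (h N ℕ.≤-refl)
      in ℚ.<-irrefl refl (ℚ.<-≤-trans 1+x<1 (subst (_≤ 1ℚ ℚ.+ seq x N)
           (≡.trans (ℚ.+-identityʳ 1ℚ) (≡.sym (ℚ.+-identityˡ 1ℚ))) (ℚ.+-monoʳ-≤ 1ℚ (0≤x N))))

    x⊗x⊕y⊗y≈0⇒x≈0 : ∀ x y → x ⊗ x ⊕ y ⊗ y ≈ᴿ fromℚ 0ℚ → x ≈ᴿ fromℚ 0ℚ
    x⊗x⊕y⊗y≈0⇒x≈0 x y s≈0 = square≈0⇒≈0 {x} (≈ᴿ-sym (squeeze {fromℚ 0ℚ} {x ⊗ x} {x ⊗ x ⊕ y ⊗ y}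
      (nonNeg-square x)
      (λ n → subst (_≤ seq x n ℚ.* seq x n ℚ.+ seq y n ℚ.* seq y n) (ℚ.+-identityʳ (seq x n ℚ.* seq x n))
        (ℚ.+-monoʳ-≤ (seq x n ℚ.* seq x n) (nonNeg-square y n)))
      (≈ᴿ-sym s≈0)))

    ⊗-cancel : ∀ x y → x ⊗ y ≈ᴿ fromℚ 0ℚ → ¬ (x ≈ᴿ fromℚ 0ℚ) → y ≈ᴿ fromℚ 0ℚ
    ⊗-cancel = ℝ-cancel

  nonNeg-normSq : ∀ z → NonNegᴿ (normSq z)
  nonNeg-normSq z = nonNeg-⊕ {re z ⊗ re z} {im z ⊗ im z} (nonNeg-square (re z)) (nonNeg-square (im z))

  normSq≈0⇒≈0 : ∀ z → normSq z ≈ᴿ fromℚ 0ℚ → z ≈ᶜ 0ᶜ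
  normSq≈0⇒≈0 z N≈0 = mk≈ᶜ
    (x⊗x⊕y⊗y≈0⇒x≈0 (re z) (im z) N≈0)
    (x⊗x⊕y⊗y≈0⇒x≈0 (im z) (re z) (≈ᴿ-trans (⊕-comm (im z ⊗ im z) (re z ⊗ re z)) N≈0))

  ℂ-commutativeRing : CommutativeRing 0ℓ 0ℓ
  ℂ-commutativeRing = commutativeRing
    (record { refl = ≈ᶜ-refl ; sym = ≈ᶜ-sym ; trans = ≈ᶜ-trans })
    ⊞-cong ⊠-cong ⊟-cong ⊞-assoc ⊠-assoc ⊞-comm ⊠-comm ⊞-identityˡ ⊠-identityˡ ⊟-inverseˡ ⊠-distribˡ-⊞

  normSq-0 : normSq 0ᶜ ≈ᴿ fromℚ 0ℚ
  normSq-0 = ≈ᴿ-trans (normSq-ofReal (fromℚ 0ℚ)) (CommutativeRing.zeroˡ ℝ-commutativeRing (fromℚ 0ℚ))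

  normSq-1 : normSq 1ᶜ ≈ᴿ fromℚ 1ℚ
  normSq-1 = ≈ᴿ-trans (normSq-ofReal (fromℚ 1ℚ)) (⊗-identityˡ (fromℚ 1ℚ))

  -- The multiplicative squared norm, which vanishes only at zero, carries cancellation over from
  -- the reals.
  ⊠-cancel : ∀ z w → z ⊠ w ≈ᶜ 0ᶜ → ¬ (z ≈ᶜ 0ᶜ) → w ≈ᶜ 0ᶜ
  ⊠-cancel z w zw≈0 z≉0 = normSq≈0⇒≈0 w (⊗-cancel (normSq z) (normSq w)
    (≈ᴿ-trans (≈ᴿ-sym (normSq-⊠ z w)) (≈ᴿ-trans (normSq-cong zw≈0) normSq-0))
    λ Nz≈0 → z≉0 (normSq≈0⇒≈0 z Nz≈0))

  module Re = DenialDomain ℝ-commutativeRing ⊗-cancel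
  module Co = DenialDomain ℂ-commutativeRing ⊠-cancel

-- Numerals, Frobenius norms and moduli of roots of unity.

module Norms where

  open Reals
  open Complexes
  open import Algebra.Bundles using (CommutativeRing)
  open import Data.Fin.Base using (Fin; zero; suc; toℕ)
  open import Data.Integer.Base as ℤ using (+_)
  import Data.Integer.Properties as ℤ
  open import Data.Nat.Base as ℕ using (ℕ; zero; suc; NonZero)
  import Data.Nat.Properties as ℕ
  open import Data.Rational.Base as ℚ using (1ℚ; 0ℚ; _/_; toℚᵘ)
  import Data.Rational.Properties as ℚ
  open import Data.Rational.Unnormalised.Base as ℚᵘ using (mkℚᵘ)
  import Data.Rational.Unnormalised.Properties as ℚᵘ
  open import Function.Base using (_∘_)
  open import Relation.Binary.PropositionalEquality as ≡ using (_≡_; refl; cong; cong₂)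
  open import Relation.Nullary using (¬_)

  module ℝ′ = CommutativeRing ℝ-commutativeRing
  module ℂ′ = CommutativeRing ℂ-commutativeRing
  open import Algebra.Properties.CommutativeSemiring.Exp ℝ′.commutativeSemiring public
    using () renaming (_^_ to _^ʳ_; ^-congˡ to ^ʳ-congˡ)
  open import Algebra.Properties.CommutativeSemiring.Exp ℂ′.commutativeSemiring public
    using (^-distrib-*; ^-assocʳ; ^-congˡ; ^-congʳ) renaming (_^_ to _^ᵒ_)
  open import Algebra.Properties.Semiring.Sum ℝ′.semiring public
    using (sum-cong-≋; ∑-comm; ∑-distrib-+) renaming (sum to sumʳ)
  open import Algebra.Properties.Semiring.Sum ℂ′.semiring public
    using () renaming (sum to sumᵒ)

  toℚᵘ-/1 : ∀ i → toℚᵘ (i / 1) ℚᵘ.≃ mkℚᵘ i 0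
  toℚᵘ-/1 i = ℚ.toℚᵘ-fromℚᵘ (mkℚᵘ i 0)

  /1-+ : ∀ i j → i / 1 ℚ.+ j / 1 ≡ (i ℤ.+ j) / 1
  /1-+ i j = ℚ.toℚᵘ-injective (begin
    toℚᵘ (i / 1 ℚ.+ j / 1)            ≈⟨ ℚ.toℚᵘ-homo-+ (i / 1) (j / 1) ⟩
    toℚᵘ (i / 1) ℚᵘ.+ toℚᵘ (j / 1)    ≈⟨ ℚᵘ.+-cong (toℚᵘ-/1 i) (toℚᵘ-/1 j) ⟩
    mkℚᵘ i 0 ℚᵘ.+ mkℚᵘ j 0            ≈⟨ ℚᵘ.*≡* (cong (ℤ._* + 1) (cong₂ ℤ._+_ (ℤ.*-identityʳ i) (ℤ.*-identityʳ j))) ⟩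
    mkℚᵘ (i ℤ.+ j) 0                  ≈⟨ toℚᵘ-/1 (i ℤ.+ j) ⟨
    toℚᵘ ((i ℤ.+ j) / 1)              ∎)
    where open ℚᵘ.≃-Reasoning

  /1-* : ∀ i j → i / 1 ℚ.* (j / 1) ≡ (i ℤ.* j) / 1
  /1-* i j = ℚ.toℚᵘ-injective (begin
    toℚᵘ (i / 1 ℚ.* (j / 1))          ≈⟨ ℚ.toℚᵘ-homo-* (i / 1) (j / 1) ⟩
    toℚᵘ (i / 1) ℚᵘ.* toℚᵘ (j / 1)    ≈⟨ ℚᵘ.*-cong (toℚᵘ-/1 i) (toℚᵘ-/1 j) ⟩
    mkℚᵘ i 0 ℚᵘ.* mkℚᵘ j 0            ≈⟨ toℚᵘ-/1 (i ℤ.* j) ⟨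
    toℚᵘ ((i ℤ.* j) / 1)              ∎)
    where open ℚᵘ.≃-Reasoning

  1/n*n≡1 : ∀ n .{{_ : NonZero n}} → + 1 / n ℚ.* (+ n / 1) ≡ 1ℚ
  1/n*n≡1 n@(suc k) = ℚ.toℚᵘ-injective (begin
    toℚᵘ (+ 1 / n ℚ.* (+ n / 1))          ≈⟨ ℚ.toℚᵘ-homo-* (+ 1 / n) (+ n / 1) ⟩
    toℚᵘ (+ 1 / n) ℚᵘ.* toℚᵘ (+ n / 1)    ≈⟨ ℚᵘ.*-cong (ℚ.toℚᵘ-fromℚᵘ (mkℚᵘ (+ 1) k)) (toℚᵘ-/1 (+ n)) ⟩
    mkℚᵘ (+ 1) k ℚᵘ.* mkℚᵘ (+ n) 0        ≈⟨ ℚᵘ.*≡* (≡.trans (ℤ.*-identityʳ _) (cong (ℤ._*_ (+ 1)) (cong +_ (≡.sym (ℕ.*-identityʳ n))))) ⟩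
    toℚᵘ 1ℚ                               ∎)
    where open ℚᵘ.≃-Reasoning

  nonNeg-fromℕ : ∀ n → NonNegᴿ (fromℕ n)
  nonNeg-fromℕ n _ = ℚ.nonNegative⁻¹ (+ n / 1) {{ℚ.normalize-nonNeg n 1}}

  fromℚ-cong : ∀ {p q} → p ≡ q → fromℚ p ≈ᴿ fromℚ q
  fromℚ-cong refl = ≈ᴿ-refl

  opaque
    unfolding _⊕_

    fromℚ-+ : ∀ p q → fromℚ p ⊕ fromℚ q ≈ᴿ fromℚ (p ℚ.+ q)
    fromℚ-+ p q = pointwise λ _ → refl

    fromℚ-* : ∀ p q → fromℚ p ⊗ fromℚ q ≈ᴿ fromℚ (p ℚ.* q)
    fromℚ-* p q = pointwise λ _ → refl

    *ᴿ-ᴿ≈⊗⊖ : ∀ x y z → x *ᴿ (y -ᴿ z) ≈ᴿ x ⊗ (y ⊕ ⊖ z)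
    *ᴿ-ᴿ≈⊗⊖ x y z = pointwise λ _ → refl

    ^ᴿ2≈*ᴿ : ∀ x → x ^ᴿ 2 ≈ᴿ x *ᴿ x
    ^ᴿ2≈*ᴿ x = pointwise λ n → cong (seq x n ℚ.*_) (ℚ.*-identityʳ (seq x n))

    re²+im²≈normSq : ∀ z → re z *ᴿ re z +ᴿ im z *ᴿ im z ≈ᴿ normSq z
    re²+im²≈normSq z = pointwise λ n → refl

    nonNeg-re²+im² : ∀ z → NonNegᴿ (re z *ᴿ re z +ᴿ im z *ᴿ im z)
    nonNeg-re²+im² = nonNeg-normSq

  √-^ᴿ2 : ∀ {x s} → s ≡ √ x → NonNegᴿ x → s ^ᴿ 2 ≈ᴿ x
  √-^ᴿ2 {x} refl 0≤x = ≈ᴿ-trans (^ᴿ2≈*ᴿ (√ x)) (√x*√x≈x x 0≤x)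

  modulusSq : ∀ z → ∣ z ∣ᶜ ^ᴿ 2 ≈ᴿ normSq z
  modulusSq z = ≈ᴿ-trans (√-^ᴿ2 {re z *ᴿ re z +ᴿ im z *ᴿ im z} {∣ z ∣ᶜ} refl (nonNeg-re²+im² z)) (re²+im²≈normSq z)

  fromℕ-suc : ∀ n → fromℚ 1ℚ ⊕ fromℕ n ≈ᴿ fromℕ (suc n)
  fromℕ-suc n = ≈ᴿ-trans (fromℚ-+ 1ℚ (+ n / 1)) (fromℚ-cong (/1-+ (+ 1) (+ n)))

  fromℕ-* : ∀ m n → fromℕ m ⊗ fromℕ n ≈ᴿ fromℕ (m ℕ.* n)
  fromℕ-* m n = ≈ᴿ-trans (fromℚ-* (+ m / 1) (+ n / 1))
    (fromℚ-cong (≡.trans (/1-* (+ m) (+ n)) (cong (_/ 1) (≡.sym (ℤ.pos-* m n)))))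

  fromℚ-inverse : ∀ n .{{_ : NonZero n}} → fromℚ (+ 1 / n) ⊗ fromℕ n ≈ᴿ fromℚ 1ℚ
  fromℚ-inverse n = ≈ᴿ-trans (fromℚ-* (+ 1 / n) (+ n / 1)) (fromℚ-cong (1/n*n≡1 n))

  -- (r q) (1/p)² (1/q)² q (2 p) = 2 r / p = 2 (1 - 1/p) when p = 1 + r.
  normSq-total : ∀ {R Q P c d t} → c ⊗ P ≈ᴿ fromℚ 1ℚ → d ⊗ Q ≈ᴿ fromℚ 1ℚ → fromℚ 1ℚ ⊕ R ≈ᴿ P →
    (R ⊗ Q) ⊗ ((c ⊗ c) ⊗ (d ⊗ d) ⊗ (Q ⊗ (t ⊗ P))) ≈ᴿ t ⊗ (fromℚ 1ℚ ⊕ ⊖ c)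
  normSq-total {R} {Q} {P} {c} {d} {t} cP≈1 dQ≈1 1+R≈P = begin
    (R ⊗ Q) ⊗ ((c ⊗ c) ⊗ (d ⊗ d) ⊗ (Q ⊗ (t ⊗ P)))
      ≈⟨ solve 6 (λ R Q c d t P → (R :* Q) :* ((c :* c) :* (d :* d) :* (Q :* (t :* P)))
           := t :* ((d :* Q) :* (d :* Q) :* (c :* P) :* (c :* R))) ℝ′.refl R Q c d t P ⟩
    t ⊗ ((d ⊗ Q) ⊗ (d ⊗ Q) ⊗ (c ⊗ P) ⊗ (c ⊗ R))
      ≈⟨ ℝ′.*-congˡ (ℝ′.*-congʳ (ℝ′.*-cong (ℝ′.*-cong dQ≈1 dQ≈1) cP≈1)) ⟩
    t ⊗ (𝟙 ⊗ 𝟙 ⊗ 𝟙 ⊗ (c ⊗ R))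
      ≈⟨ solve 3 (λ t c R → t :* (con 1 :* con 1 :* con 1 :* (c :* R)) := t :* (c :* R)) ℝ′.refl t c R ⟩
    t ⊗ (c ⊗ R)
      ≈⟨ ℝ′.*-congˡ (+-cancelʳ c (c ⊗ R) (𝟙 ⊕ ⊖ c) (begin
           c ⊗ R ⊕ c                ≈⟨ solve 2 (λ c R → c :* R :+ c := c :* (con 1 :+ R)) ℝ′.refl c R ⟩
           c ⊗ (𝟙 ⊕ R)              ≈⟨ ℝ′.trans (ℝ′.*-congˡ 1+R≈P) cP≈1 ⟩
           𝟙                        ≈⟨ //-rightDividesˡ c 𝟙 ⟨
           𝟙 ⊕ ⊖ c ⊕ c              ∎)) ⟩
    t ⊗ (𝟙 ⊕ ⊖ c) ∎
    where
    open import Relation.Binary.Reasoning.Setoid ℝ′.setoid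
    open import Algebra.Solver.Ring.NaturalCoefficients.Default ℝ′.commutativeSemiring
    open import Algebra.Properties.Ring ℝ′.ring using (+-cancelʳ; //-rightDividesˡ)
    𝟙 = fromℚ 1ℚ

  sumʳ-const : ∀ n x → sumʳ {n} (λ _ → x) ≈ᴿ fromℕ n ⊗ x
  sumʳ-const zero    x = ≈ᴿ-sym (ℝ′.zeroˡ x)
  sumʳ-const (suc n) x = ℝ′.trans (ℝ′.+-cong (ℝ′.sym (ℝ′.*-identityˡ x)) (sumʳ-const n x))
    (ℝ′.trans (ℝ′.sym (ℝ′.distribʳ x (fromℚ 1ℚ) (fromℕ n))) (ℝ′.*-congʳ (fromℕ-suc n)))

  ∑1≈fromℕ : ∀ n → Co.∑< n (λ _ → 1ᶜ) ≈ᶜ ofReal (fromℕ n)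
  ∑1≈fromℕ zero    = ≈ᶜ-refl
  ∑1≈fromℕ (suc n) = ℂ′.trans (ℂ′.+-congˡ (∑1≈fromℕ n))
    (ℂ′.trans (ofReal-⊞ (fromℚ 1ℚ) (fromℕ n)) (mk≈ᶜ (fromℕ-suc n) ≈ᴿ-refl))

  re-∑< : ∀ n f → re (Co.∑< n f) ≈ᴿ Re.∑< n (re ∘ f)
  re-∑< zero    f = ≈ᴿ-refl
  re-∑< (suc n) f = ℝ′.trans (re-⊞ (f 0) (Co.∑< n (f ∘ suc))) (ℝ′.+-congˡ (re-∑< n (f ∘ suc)))

  -- Powers and sums in the theorem are built on transparent operations, those of the ring theory on
  -- opaque ones. This lemma and the next two cross over, unfolding one step at a time inside an
  -- opaque block.
  ^ᶜ≈^ᵒ : ∀ z n → z ^ᶜ n ≈ᶜ z ^ᵒ n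
  ^ᶜ≈^ᵒ z zero    = ≈ᶜ-refl
  ^ᶜ≈^ᵒ z (suc n) = ℂ′.trans (unfold z n) (ℂ′.*-congˡ (^ᶜ≈^ᵒ z n))
    where
    opaque
      unfolding _⊕_ _⊞_
      unfold : ∀ z n → z ^ᶜ suc n ≈ᶜ z ⊠ z ^ᶜ n
      unfold z n = mk≈ᶜ (pointwise λ _ → refl) (pointwise λ _ → refl)

  sumᶜ≈sumᵒ : ∀ {k} {f g : Fin k → ℂ} → (∀ i → f i ≈ᶜ g i) → sumᶜ f ≈ᶜ sumᵒ g
  sumᶜ≈sumᵒ {zero}          f≈g = ≈ᶜ-refl
  sumᶜ≈sumᵒ {suc k} {f} {g} f≈g = ℂ′.trans (unfold f) (ℂ′.+-cong (f≈g zero) (sumᶜ≈sumᵒ {k} (f≈g ∘ suc)))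
    where
    opaque
      unfolding _⊕_ _⊞_
      unfold : ∀ {k} (f : Fin (suc k) → ℂ) → sumᶜ f ≈ᶜ f zero ⊞ sumᶜ (λ i → f (suc i))
      unfold f = mk≈ᶜ (pointwise λ _ → refl) (pointwise λ _ → refl)

  sumᴿ≈sumʳ : ∀ {k} {f g : Fin k → ℝ} → (∀ i → f i ≈ᴿ g i) → sumᴿ f ≈ᴿ sumʳ g
  sumᴿ≈sumʳ {zero}          f≈g = ≈ᴿ-refl
  sumᴿ≈sumʳ {suc k} {f} {g} f≈g = ℝ′.trans (unfold f) (ℝ′.+-cong (f≈g zero) (sumᴿ≈sumʳ {k} (f≈g ∘ suc)))
    where
    opaque
      unfolding _⊕_
      unfold : ∀ {k} (f : Fin (suc k) → ℝ) → sumᴿ f ≈ᴿ f zero ⊕ sumᴿ (λ i → f (suc i))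
      unfold f = pointwise λ _ → refl

  *ᴹ-entry : ∀ {k} (A B : Matrix k) {A′ B′ : Matrix k} → A ≈ᴹ A′ → B ≈ᴹ B′ →
             ∀ i j → (A *ᴹ B) i j ≈ᶜ sumᵒ (λ l → A′ i l ⊠ B′ l j)
  *ᴹ-entry A B A≈ B≈ i j = sumᶜ≈sumᵒ λ l →
    ℂ′.trans (*ᶜ≈⊠ (A i l) (B l j)) (ℂ′.*-cong (A≈ i l) (B≈ l j))

  frobenius≈√ : ∀ {k} (A : Matrix k) {x} → sumʳ (λ i → sumʳ λ j → normSq (A i j)) ≈ᴿ x → frobenius A ≈ᴿ √ x
  frobenius≈√ A {x} total = √-cong {sumᴿ λ i → sumᴿ λ j → ∣ A i j ∣ᶜ ^ᴿ 2} {x}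
    (ℝ′.trans (sumᴿ≈sumʳ λ i → sumᴿ≈sumʳ λ j → modulusSq (A i j)) total)

  normSq-^ : ∀ z n → normSq (z ^ᵒ n) ≈ᴿ normSq z ^ʳ n
  normSq-^ z zero    = normSq-1
  normSq-^ z (suc n) = ℝ′.trans (normSq-⊠ z (z ^ᵒ n)) (ℝ′.*-congˡ (normSq-^ z n))

  nonNeg-geometric : ∀ {x} n → NonNegᴿ x → NonNegᴿ (sumʳ {n} (λ i → x ^ʳ suc (toℕ i)))
  nonNeg-geometric {x} n 0≤x = nonNeg-sum n λ i → nonNeg-^ (suc (toℕ i))
    where
    nonNeg-^ : ∀ n → NonNegᴿ (x ^ʳ n)
    nonNeg-^ zero    = nonNeg-fromℕ 1
    nonNeg-^ (suc n) = nonNeg-⊗ {x} {x ^ʳ n} 0≤x (nonNeg-^ n)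

    nonNeg-sum : ∀ n {f : Fin n → ℝ} → (∀ i → NonNegᴿ (f i)) → NonNegᴿ (sumʳ f)
    nonNeg-sum zero    0≤f = nonNeg-fromℕ 0
    nonNeg-sum (suc n) {f} 0≤f = nonNeg-⊕ {f zero} {sumʳ (f ∘ suc)} (0≤f zero) (nonNeg-sum n (0≤f ∘ suc))

  -- The squared norm N satisfies N^(n+1) = 1, hence (N - 1)(1 + N + ⋯ + N^n) = 0. The second factor
  -- is 1 plus a nonnegative number and may be cancelled.
  root-of-unity⇒normSq≈1 : ∀ {z} n → z ^ᵒ suc n ≈ᶜ 1ᶜ → normSq z ≈ᴿ fromℚ 1ℚ
  root-of-unity⇒normSq≈1 {z} n zⁿ≈1 = x∙y⁻¹≈ε⇒x≈y N (fromℚ 1ℚ) (⊗-cancel G (N ℝ′.- fromℚ 1ℚ)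
    (ℝ′.trans (ℝ′.*-comm G (N ℝ′.- fromℚ 1ℚ)) (ℝ′.trans ([y-z]x≈yx-zx G N (fromℚ 1ℚ))
      (x≈y⇒x∙y⁻¹≈ε {N ⊗ G} {fromℚ 1ℚ ⊗ G} (Re.*geometric {N} (suc n) Nⁿ≈1))))
    (1⊕nonNeg≉0 {sumʳ {n} (λ i → N ^ʳ suc (toℕ i))} (nonNeg-geometric {N} n (nonNeg-normSq z))))
    where
    open import Algebra.Properties.Ring ℝ′.ring
    N = normSq z
    G = Re.geometric N (suc n)
    Nⁿ≈1 : N ^ʳ suc n ≈ᴿ fromℚ 1ℚ
    Nⁿ≈1 = ℝ′.trans (ℝ′.sym (normSq-^ z (suc n))) (ℝ′.trans (normSq-cong {z ^ᵒ suc n} {1ᶜ} zⁿ≈1) normSq-1)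

  normSq-power : ∀ {z} n → normSq z ≈ᴿ fromℚ 1ℚ → normSq (z ^ᵒ n) ≈ᴿ fromℚ 1ℚ
  normSq-power {z} n N≈1 = ℝ′.trans (normSq-^ z n) (ℝ′.trans (^ʳ-congˡ n N≈1) (Re.1^n≈1 n))

  -- ∣1 - w∣² = 2 - 2 Re w for ∣w∣ = 1, and the powers θ, …, θ ^ r have real parts summing to -1.
  ∑-normSq[1-θ] : ∀ {θ} r → θ ^ᵒ suc r ≈ᶜ 1ᶜ → ¬ (θ ≈ᶜ 1ᶜ) →
    Re.∑< r (λ a → normSq (1ᶜ ⊞ ⊟ (θ ^ᵒ suc a))) ≈ᴿ fromℕ 2 ⊗ fromℕ (suc r)
  ∑-normSq[1-θ] {θ} r θᵖ≈1 θ≉1 = begin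
    T                                      ≈⟨ solve 1 (λ t → t := t :+ (con 0 :+ con 0)) ℝ′.refl T ⟩
    T ⊕ (𝟘 ⊕ 𝟘)                            ≈⟨ ℝ′.+-congˡ (ℝ′.+-cong 1+R≈0 1+R≈0) ⟨
    T ⊕ ((𝟙 ⊕ R) ⊕ (𝟙 ⊕ R))                ≈⟨ solve 2 (λ t r → t :+ ((con 1 :+ r) :+ (con 1 :+ r))
                                                := (t :+ (r :+ r)) :+ (con 1 :+ con 1)) ℝ′.refl T R ⟩
    (T ⊕ (R ⊕ R)) ⊕ (𝟙 ⊕ 𝟙)                ≈⟨ ℝ′.+-congʳ T+R+R ⟩
    (fromℕ r ⊗ (𝟙 ⊕ 𝟙)) ⊕ (𝟙 ⊕ 𝟙)          ≈⟨ solve 1 (λ n → n :* con 2 :+ con 2 := con 2 :* (con 1 :+ n)) ℝ′.refl (fromℕ r) ⟩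
    (𝟙 ⊕ 𝟙) ⊗ (𝟙 ⊕ fromℕ r)                ≈⟨ ℝ′.*-cong (fromℕ-suc 1) (fromℕ-suc r) ⟩
    fromℕ 2 ⊗ fromℕ (suc r)                ∎
    where
    open import Relation.Binary.Reasoning.Setoid ℝ′.setoid
    open import Algebra.Solver.Ring.NaturalCoefficients.Default ℝ′.commutativeSemiring
    𝟘 = fromℚ 0ℚ
    𝟙 = fromℚ 1ℚ
    D S : ℕ → ℝ
    D a = normSq (1ᶜ ⊞ ⊟ (θ ^ᵒ suc a))
    S a = re (θ ^ᵒ suc a)
    T = Re.∑< r D
    R = Re.∑< r S

    1+R≈0 : 𝟙 ⊕ R ≈ᴿ 𝟘
    1+R≈0 = ℝ′.trans (ℝ′.sym (re-∑< (suc r) (θ ^ᵒ_))) (re-≈ (Co.geometric≈0 (suc r) θᵖ≈1 θ≉1))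

    T+R+R : T ⊕ (R ⊕ R) ≈ᴿ fromℕ r ⊗ (𝟙 ⊕ 𝟙)
    T+R+R = begin
      T ⊕ (R ⊕ R)                              ≈⟨ ℝ′.+-congˡ (∑-distrib-+ {r} (S ∘ toℕ) (S ∘ toℕ)) ⟨
      T ⊕ Re.∑< r (λ a → S a ⊕ S a)            ≈⟨ ∑-distrib-+ {r} (D ∘ toℕ) (λ i → S (toℕ i) ⊕ S (toℕ i)) ⟨
      Re.∑< r (λ a → D a ⊕ (S a ⊕ S a))        ≈⟨ Re.∑<-cong r {λ a → D a ⊕ (S a ⊕ S a)} {λ _ → 𝟙 ⊕ 𝟙} (λ a _ →
                                                    ℝ′.trans (normSq-1⊟ (θ ^ᵒ suc a)) (ℝ′.+-congˡ
                                                      (normSq-power {θ} (suc a) (root-of-unity⇒normSq≈1 {θ} r θᵖ≈1)))) ⟩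
      Re.∑< r (λ _ → 𝟙 ⊕ 𝟙)                    ≈⟨ sumʳ-const r (𝟙 ⊕ 𝟙) ⟩
      fromℕ r ⊗ (𝟙 ⊕ 𝟙)                        ∎

-- The inverse matrix and both Frobenius norms, for either sign.

module ConditionNumber where

  open Reals
  open Complexes
  open Norms
  open import Data.Fin.Base using (Fin; toℕ)
  open import Data.Integer.Base using (+_)
  open import Data.Nat.Base as ℕ using (ℕ; suc; NonZero; _*_)
  open import Data.Product.Base using (Σ; _×_; _,_)
  open import Data.Rational.Base as ℚ using (ℚ; _/_; 1ℚ)
  open import Data.Vec.Functional using (Vector)
  open import Relation.Binary.PropositionalEquality using (_≡_; refl)
  open import Relation.Nullary using (¬_)

  cond≈ : ∀ {k} (A B : Matrix k) (inverse : A *ᴹ B ≈ᴹ 1ᴹ × B *ᴹ A ≈ᴹ 1ᴹ) {x y} →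
          frobenius A ≈ᴿ x → frobenius B ≈ᴿ y → Cond A (B , inverse) ≈ᴿ x *ᴿ y
  cond≈ A B inverse {x} {y} = *ᴿ-cong {frobenius A} {x} {frobenius B} {y}

  -- The common core of the two families. Here `n` is one less than the order of the roots. The
  -- rational `1/p` is given by its defining equation, so it can be the very fraction in the
  -- theorem, whatever proof that p is nonzero it carries.
  module _ (r q n : ℕ) .{{_ : NonZero q}} (ζ : Vector ℂ (r * q)) (ε : ℂ)
    (1/p : ℚ) (1/p*p≡1 : 1/p ℚ.* (+ suc r / 1) ≡ 1ℚ)
    (distinct : ∀ i j → ζ i ≈ᶜ ζ j → i ≡ j)
    (ζⁿ≈1 : ∀ i → ζ i ^ᵒ suc n ≈ᶜ 1ᶜ)
    (εε≈1 : ε ⊠ ε ≈ᶜ 1ᶜ)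
    (θᵖ≈1 : ∀ i → (ε ⊠ ζ i ^ᵒ q) ^ᵒ suc r ≈ᶜ 1ᶜ)
    (θ≉1 : ∀ i → ¬ (ε ⊠ ζ i ^ᵒ q ≈ᶜ 1ᶜ))
    where

    private
      p = suc r
      1/q = fromℚ (+ 1 / q)

      ξ θ ω : Fin (r * q) → ℂ
      -- As ζ^(n+1) = 1 in this module, the power ζ^n is the inverse of ζ.
      ξ i = ζ i ^ᵒ n
      θ i = ε ⊠ ζ i ^ᵒ q
      ω i = ε ⊠ ξ i ^ᵒ q

      c : ℂ
      c = ofReal (fromℚ 1/p) ⊠ ofReal 1/q

      V⁻¹ : Matrix (r * q)
      V⁻¹ j i = Co.inverseEntry q ξ θ c (toℕ j) i

      open import Algebra.Properties.CommutativeSemigroup ℂ′.*-commutativeSemigroup using (interchange)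

      -- The two signs cancel. With w the inverse of some root this yields both that `ω` inverts `θ`
      -- and that (ζ i ξ j)^q = θ i ω j, the only link between q-th powers and `θ` that the
      -- interpolation needs.
      [zw]^q : ∀ z w → (ε ⊠ z ^ᵒ q) ⊠ (ε ⊠ w ^ᵒ q) ≈ᶜ (z ⊠ w) ^ᵒ q
      [zw]^q z w = begin
        (ε ⊠ z ^ᵒ q) ⊠ (ε ⊠ w ^ᵒ q)    ≈⟨ interchange ε (z ^ᵒ q) ε (w ^ᵒ q) ⟩
        (ε ⊠ ε) ⊠ (z ^ᵒ q ⊠ w ^ᵒ q)    ≈⟨ ℂ′.*-cong εε≈1 (ℂ′.sym (^-distrib-* z w q)) ⟩
        1ᶜ ⊠ (z ⊠ w) ^ᵒ q              ≈⟨ ℂ′.*-identityˡ ((z ⊠ w) ^ᵒ q) ⟩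
        (z ⊠ w) ^ᵒ q                   ∎
        where open import Relation.Binary.Reasoning.Setoid ℂ′.setoid

      ωθ≈1 : ∀ i → ω i ⊠ θ i ≈ᶜ 1ᶜ
      ωθ≈1 i = ℂ′.trans ([zw]^q (ξ i) (ζ i)) (ℂ′.trans
        (^-congˡ q (ℂ′.trans (ℂ′.*-comm (ξ i) (ζ i)) (ζⁿ≈1 i))) (Co.1^n≈1 q))

      ofReal-cong : ∀ {x y} → x ≈ᴿ y → ofReal x ≈ᶜ ofReal y
      ofReal-cong x≈y = mk≈ᶜ x≈y ≈ᴿ-refl

      1/p⊗p≈1 : fromℚ 1/p ⊗ fromℕ p ≈ᴿ fromℚ 1ℚ
      1/p⊗p≈1 = ℝ′.trans (fromℚ-* 1/p (+ p / 1)) (fromℚ-cong 1/p*p≡1)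

      c-inverse : c ⊠ (Co.∑< q (λ _ → 1ᶜ) ⊠ Co.∑< p (λ _ → 1ᶜ)) ≈ᶜ 1ᶜ
      c-inverse = begin
        c ⊠ (Co.∑< q (λ _ → 1ᶜ) ⊠ Co.∑< p (λ _ → 1ᶜ))
          ≈⟨ ℂ′.*-congˡ (ℂ′.trans (ℂ′.*-cong (∑1≈fromℕ q) (∑1≈fromℕ p)) (ℂ′.*-comm (ofReal (fromℕ q)) (ofReal (fromℕ p)))) ⟩
        (ofReal (fromℚ 1/p) ⊠ ofReal 1/q) ⊠ (ofReal (fromℕ p) ⊠ ofReal (fromℕ q))
          ≈⟨ interchange (ofReal (fromℚ 1/p)) (ofReal 1/q) (ofReal (fromℕ p)) (ofReal (fromℕ q)) ⟩
        (ofReal (fromℚ 1/p) ⊠ ofReal (fromℕ p)) ⊠ (ofReal 1/q ⊠ ofReal (fromℕ q))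
          ≈⟨ ℂ′.*-cong p-inverse q-inverse ⟩
        1ᶜ ⊠ 1ᶜ
          ≈⟨ ℂ′.*-identityˡ 1ᶜ ⟩
        1ᶜ ∎
        where
        open import Relation.Binary.Reasoning.Setoid ℂ′.setoid
        p-inverse = ℂ′.trans (ofReal-⊠ (fromℚ 1/p) (fromℕ p)) (ofReal-cong 1/p⊗p≈1)
        q-inverse = ℂ′.trans (ofReal-⊠ 1/q (fromℕ q)) (ofReal-cong (fromℚ-inverse q))

      V≈ : vandermonde ζ ≈ᴹ λ i j → ζ i ^ᵒ toℕ j
      V≈ i j = ^ᶜ≈^ᵒ (ζ i) (toℕ j)

      rightInverse : ∀ i j → _
      rightInverse = Co.vandermonde-rightInverse r q {ζ} {ξ} {θ} {ω} {c} distinct ζⁿ≈1 ωθ≈1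
        (λ i j → ℂ′.sym ([zw]^q (ζ i) (ξ j))) θᵖ≈1 θ≉1 c-inverse

      inverses : vandermonde ζ *ᴹ V⁻¹ ≈ᴹ 1ᴹ × V⁻¹ *ᴹ vandermonde ζ ≈ᴹ 1ᴹ
      inverses
        = (λ i j → ℂ′.trans (*ᴹ-entry (vandermonde ζ) V⁻¹ V≈ (λ _ _ → ≈ᶜ-refl) i j) (rightInverse i j))
        , (λ i j → ℂ′.trans (*ᴹ-entry V⁻¹ (vandermonde ζ) (λ _ _ → ≈ᶜ-refl) V≈ i j)
            (Co.vandermonde-leftInverse ζ V⁻¹ distinct rightInverse i j))

      normSq-ζ : ∀ i → normSq (ζ i) ≈ᴿ fromℚ 1ℚ
      normSq-ζ i = root-of-unity⇒normSq≈1 n (ζⁿ≈1 i)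

      open import Relation.Binary.Reasoning.Setoid ℝ′.setoid

      frobenius-V : frobenius (vandermonde ζ) ≈ᴿ fromℕ (r * q)
      frobenius-V = ℝ′.trans (frobenius≈√ (vandermonde ζ) {fromℕ (r * q) *ᴿ fromℕ (r * q)} (begin
        sumʳ (λ i → sumʳ λ j → normSq (vandermonde ζ i j))
          ≈⟨ sum-cong-≋ {r * q} (λ i → sum-cong-≋ {r * q} λ j →
               ℝ′.trans (normSq-cong (V≈ i j)) (normSq-power (toℕ j) (normSq-ζ i))) ⟩
        sumʳ {r * q} (λ _ → sumʳ {r * q} λ _ → fromℚ 1ℚ)
          ≈⟨ ℝ′.trans (sumʳ-const (r * q) (sumʳ {r * q} λ _ → fromℚ 1ℚ)) (ℝ′.*-congˡ
               (ℝ′.trans (sumʳ-const (r * q) (fromℚ 1ℚ)) (ℝ′.*-identityʳ (fromℕ (r * q))))) ⟩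
        fromℕ (r * q) ⊗ fromℕ (r * q)
          ≈⟨ *ᴿ≈⊗ (fromℕ (r * q)) (fromℕ (r * q)) ⟨
        fromℕ (r * q) *ᴿ fromℕ (r * q) ∎)) (√[x*x]≈x (fromℕ (r * q)) (nonNeg-fromℕ (r * q)))

      C = (fromℚ 1/p ⊗ fromℚ 1/p) ⊗ (1/q ⊗ 1/q)

      D : Fin (r * q) → ℕ → ℝ
      D i a = normSq (1ᶜ ⊞ ⊟ (θ i ^ᵒ suc a))

      normSq-c : normSq c ≈ᴿ C
      normSq-c = ℝ′.trans (normSq-⊠ (ofReal (fromℚ 1/p)) (ofReal 1/q)) (ℝ′.*-cong (normSq-ofReal (fromℚ 1/p)) (normSq-ofReal 1/q))

      normSq-entry : ∀ i t → normSq (Co.inverseEntry q ξ θ c t i) ≈ᴿ C ⊗ D i (t ℕ./ q)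
      normSq-entry i t = begin
        normSq (c ⊠ (ξ i ^ᵒ t ⊠ w))             ≈⟨ normSq-⊠ c (ξ i ^ᵒ t ⊠ w) ⟩
        normSq c ⊗ normSq (ξ i ^ᵒ t ⊠ w)        ≈⟨ ℝ′.*-cong normSq-c (normSq-⊠ (ξ i ^ᵒ t) w) ⟩
        C ⊗ (normSq (ξ i ^ᵒ t) ⊗ normSq w)      ≈⟨ ℝ′.*-congˡ (ℝ′.*-congʳ (normSq-power t (normSq-power n (normSq-ζ i)))) ⟩
        C ⊗ (fromℚ 1ℚ ⊗ normSq w)               ≈⟨ ℝ′.*-congˡ (ℝ′.*-identityˡ (normSq w)) ⟩
        C ⊗ normSq w                            ∎
        where w = 1ᶜ ⊞ ⊟ (θ i ^ᵒ suc (t ℕ./ q))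

      K = C ⊗ (fromℕ q ⊗ (fromℕ 2 ⊗ fromℕ p))

      -- All columns have the same norm, because the sum of ∣1 - θ^a∣² over 0 < a < p is the same
      -- for every nontrivial p-th root of unity θ.
      column : ∀ i → Re.∑< (r * q) (λ t → normSq (Co.inverseEntry q ξ θ c t i)) ≈ᴿ K
      column i = begin
        Re.∑< (r * q) (λ t → normSq (Co.inverseEntry q ξ θ c t i))
          ≈⟨ Re.∑<-cong (r * q) {λ t → normSq (Co.inverseEntry q ξ θ c t i)} {λ t → C ⊗ D i (t ℕ./ q)} (λ t _ → normSq-entry i t) ⟩
        Re.∑< (r * q) (λ t → C ⊗ D i (t ℕ./ q))
          ≈⟨ Re.*-distribˡ-∑< (r * q) C (λ t → D i (t ℕ./ q)) ⟨
        C ⊗ Re.∑< (r * q) (λ t → D i (t ℕ./ q))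
          -- Each quotient a < r occurs for exactly q values of t.
          ≈⟨ ℝ′.*-congˡ (Re.∑<-divMod r q (λ a _ → D i a)) ⟩
        C ⊗ Re.∑< r (λ a → Re.∑< q (λ _ → D i a))
          ≈⟨ ℝ′.*-congˡ (Re.∑<-cong r {λ a → Re.∑< q (λ _ → D i a)} {λ a → fromℕ q ⊗ D i a} (λ a _ → sumʳ-const q (D i a))) ⟩
        C ⊗ Re.∑< r (λ a → fromℕ q ⊗ D i a)
          ≈⟨ ℝ′.*-congˡ (Re.*-distribˡ-∑< r (fromℕ q) (D i)) ⟨
        C ⊗ (fromℕ q ⊗ Re.∑< r (D i))
          ≈⟨ ℝ′.*-congˡ (ℝ′.*-congˡ (∑-normSq[1-θ] r (θᵖ≈1 i) (θ≉1 i))) ⟩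
        K ∎

      frobenius-V⁻¹ : frobenius V⁻¹ ≈ᴿ √ (fromℕ 2 *ᴿ (fromℕ 1 -ᴿ fromℚ 1/p))
      frobenius-V⁻¹ = frobenius≈√ V⁻¹ {fromℕ 2 *ᴿ (fromℕ 1 -ᴿ fromℚ 1/p)} (begin
        sumʳ (λ j → sumʳ λ i → normSq (V⁻¹ j i))
          -- Summing by columns keeps ζ fixed; a sum along a row would require knowing how often
          -- each θ occurs among the roots.
          ≈⟨ ∑-comm {r * q} {r * q} (λ j i → normSq (V⁻¹ j i)) ⟩
        sumʳ (λ i → sumʳ λ j → normSq (V⁻¹ j i))
          ≈⟨ sum-cong-≋ {r * q} column ⟩
        sumʳ {r * q} (λ _ → K)
          ≈⟨ sumʳ-const (r * q) K ⟩
        fromℕ (r * q) ⊗ K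
          ≈⟨ ℝ′.*-congʳ (fromℕ-* r q) ⟨
        (fromℕ r ⊗ fromℕ q) ⊗ K
          ≈⟨ normSq-total {fromℕ r} {fromℕ q} {fromℕ p} {fromℚ 1/p} {1/q} {fromℕ 2}
               1/p⊗p≈1 (fromℚ-inverse q) (fromℕ-suc r) ⟩
        fromℕ 2 ⊗ (fromℚ 1ℚ ⊕ ⊖ fromℚ 1/p)
          ≈⟨ ℝ′.*-congˡ (ℝ′.+-congʳ (fromℚ-cong {1ℚ} {+ 1 / 1} refl)) ⟩
        fromℕ 2 ⊗ (fromℕ 1 ⊕ ⊖ fromℚ 1/p)
          ≈⟨ *ᴿ-ᴿ≈⊗⊖ (fromℕ 2) (fromℕ 1) (fromℚ 1/p) ⟨
        fromℕ 2 *ᴿ (fromℕ 1 -ᴿ fromℚ 1/p) ∎)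

    cond-vandermonde : Σ (Invertible (vandermonde ζ)) λ V⁻¹ →
      Cond (vandermonde ζ) V⁻¹ ≈ᴿ fromℕ (r * q) *ᴿ √ (fromℕ 2 *ᴿ (fromℕ 1 -ᴿ fromℚ 1/p))
    cond-vandermonde = (V⁻¹ , inverses) , cond≈ (vandermonde ζ) V⁻¹ inverses {fromℕ (r * q)}
      {√ (fromℕ 2 *ᴿ (fromℕ 1 -ᴿ fromℚ 1/p))} frobenius-V frobenius-V⁻¹

-- Primitive roots of order p^k and 2^k p^ℓ.

open import Data.Integer.Base using (+_)
open import Data.Nat.Base using (ℕ; zero; suc; NonZero; _*_; _^_; _<_; pred; s≤s; z<s; nonTrivial⇒n>1; >-nonZero⁻¹)
open import Data.Nat.Divisibility using (_∣_)
open import Data.Nat.Primality using (Prime; prime⇒nonZero; prime⇒nonTrivial; ¬prime[0])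
import Data.Nat.Properties as ℕ
open import Data.Nat.Tactic.RingSolver using (solve-∀)
open import Data.Product.Base using (Σ; ∃-syntax; _×_; _,_)
open import Data.Rational.Base as ℚ using (_/_; 1ℚ)
open import Data.Sum.Base using (_⊎_; inj₁; inj₂)
open import Data.Vec.Functional using (Vector)
open import Relation.Binary.PropositionalEquality using (_≡_; refl; subst)
open import Relation.Nullary using (¬_; contradiction)
open Totient using (2∣n⊎2∣1+n; φ[p^1+k]; φ[2^1+k*p^1+ℓ])
open Complexes
open Norms
open ConditionNumber

primitive-pow≈1 : ∀ {n z} → IsPrimitiveRoot n z → z ^ᵒ n ≈ᶜ 1ᶜ
primitive-pow≈1 {n} {z} (zⁿ≈1 , _) = ℂ′.trans (ℂ′.sym (^ᶜ≈^ᵒ z n)) zⁿ≈1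

primitive-pow≉1 : ∀ {n z} → IsPrimitiveRoot n z → ∀ d .{{_ : NonZero d}} → d < n → ¬ (z ^ᵒ d ≈ᶜ 1ᶜ)
primitive-pow≉1 {n} {z} (_ , minimal) d d<n zᵈ≈1 =
  minimal d (>-nonZero⁻¹ d) d<n (ℂ′.trans (^ᶜ≈^ᵒ z d) zᵈ≈1)

-- The dimension `m` is a variable, so the totient formula can be matched with `refl` instead of
-- transporting vectors and matrices along it.
cond-primitive : ∀ {m N} r q .{{_ : NonZero q}} .{{_ : NonZero N}} ε 1/p → 1/p ℚ.* (+ suc r / 1) ≡ 1ℚ →
  m ≡ r * q → (ζ : Vector ℂ m) → ListsPrimitiveRoots N ζ →
  ε ⊠ ε ≈ᶜ 1ᶜ →
  (∀ {z} → IsPrimitiveRoot N z → (ε ⊠ z ^ᵒ q) ^ᵒ suc r ≈ᶜ 1ᶜ) →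
  (∀ {z} → IsPrimitiveRoot N z → ¬ (ε ⊠ z ^ᵒ q ≈ᶜ 1ᶜ)) →
  Σ (Invertible (vandermonde ζ)) λ V⁻¹ →
    Cond (vandermonde ζ) V⁻¹ ≈ᴿ fromℕ m *ᴿ √ (fromℕ 2 *ᴿ (fromℕ 1 -ᴿ fromℚ 1/p))
cond-primitive {N = N} r q ε 1/p 1/p*p≡1 refl ζ lists εε≈1 θᵖ≈1 θ≉1 =
  cond-vandermonde r q (pred N) ζ ε 1/p 1/p*p≡1 distinct
    (λ i → ℂ′.trans (^-congʳ (ζ i) (ℕ.suc-pred N)) (primitive-pow≈1 (isPrimitive i)))
    εε≈1 (λ i → θᵖ≈1 (isPrimitive i)) (λ i → θ≉1 (isPrimitive i))
  where open ListsPrimitiveRoots lists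

theorem1p2 : (n p : ℕ) .{{_ : NonZero n}} (p-prime : Prime p) →
    (∃[ k ] (0 < k × n ≡ p ^ k))
    ⊎ (∃[ k ] ∃[ ℓ ] (0 < k × 0 < ℓ × ¬ (2 ∣ p) × n ≡ 2 ^ k * p ^ ℓ)) →
    (ζ : Vector ℂ (φ n)) → ListsPrimitiveRoots n ζ →
    Σ (Invertible (vandermonde ζ)) λ V⁻¹ →
    Cond (vandermonde ζ) V⁻¹
    ≈ᴿ fromℕ (φ n) *ᴿ √ (fromℕ 2 *ᴿ (fromℕ 1 -ᴿ fromℚ (_/_ (+ 1) p {{prime⇒nonZero p-prime}})))
theorem1p2 n zero p-prime = contradiction p-prime ¬prime[0]
theorem1p2 n p@(suc r) p-prime (inj₁ (suc k , _ , refl)) ζ lists =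
  cond-primitive r q 1ᶜ (_/_ (+ 1) p {{prime⇒nonZero p-prime}}) (1/n*n≡1 p)
    (φ[p^1+k] k p-prime) ζ lists (ℂ′.*-identityˡ 1ᶜ) θᵖ≈1 θ≉1
  where
  q = p ^ k
  instance
    q≢0 : NonZero q
    q≢0 = ℕ.m^n≢0 p k

  θᵖ≈1 : ∀ {z} → IsPrimitiveRoot n z → (1ᶜ ⊠ z ^ᵒ q) ^ᵒ p ≈ᶜ 1ᶜ
  θᵖ≈1 {z} prim = begin
    (1ᶜ ⊠ z ^ᵒ q) ^ᵒ p     ≈⟨ ^-congˡ p (ℂ′.*-identityˡ (z ^ᵒ q)) ⟩
    (z ^ᵒ q) ^ᵒ p          ≈⟨ ^-assocʳ z q p ⟩
    z ^ᵒ (q * p)           ≈⟨ ^-congʳ z (ℕ.*-comm q p) ⟩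
    z ^ᵒ (p * q)           ≈⟨ primitive-pow≈1 prim ⟩
    1ᶜ                     ∎
    where open import Relation.Binary.Reasoning.Setoid ℂ′.setoid

  -- Here θ = z^q with q = n/p, a positive exponent below the order of z.
  θ≉1 : ∀ {z} → IsPrimitiveRoot n z → ¬ (1ᶜ ⊠ z ^ᵒ q ≈ᶜ 1ᶜ)
  θ≉1 {z} prim θ≈1 = primitive-pow≉1 prim q
    (subst (q <_) (ℕ.*-comm q p) (ℕ.m<m*n q p (nonTrivial⇒n>1 p {{prime⇒nonTrivial p-prime}})))
    (ℂ′.trans (ℂ′.sym (ℂ′.*-identityˡ (z ^ᵒ q))) θ≈1)
theorem1p2 n p@(suc r) p-prime (inj₂ (suc k , suc ℓ , _ , _ , p-odd , refl)) ζ lists =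
  cond-primitive r q -1ᶜ (_/_ (+ 1) p {{prime⇒nonZero p-prime}}) (1/n*n≡1 p)
    (φ[2^1+k*p^1+ℓ] k ℓ p-prime p-odd) ζ lists Co.-1*-1≈1 θᵖ≈1 θ≉1
  where
  open import Relation.Binary.Reasoning.Setoid ℂ′.setoid
  -1ᶜ = ⊟ 1ᶜ
  q = 2 ^ k * p ^ ℓ
  1<p = nonTrivial⇒n>1 p {{prime⇒nonTrivial p-prime}}
  instance
    q≢0 : NonZero q
    q≢0 = ℕ.m*n≢0 (2 ^ k) (p ^ ℓ) {{ℕ.m^n≢0 2 k}} {{ℕ.m^n≢0 p ℓ}}

    qp≢0 : NonZero (q * p)
    qp≢0 = ℕ.m*n≢0 q p

    2q≢0 : NonZero (q * 2)
    2q≢0 = ℕ.m*n≢0 q 2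

  [qp]2≡n : q * p * 2 ≡ n
  [qp]2≡n = regroup (2 ^ k) (p ^ ℓ) p
    where
    regroup : ∀ a b p → a * b * p * 2 ≡ 2 * a * (p * b)
    regroup = solve-∀

  [q2]p≡n : q * 2 * p ≡ n
  [q2]p≡n = regroup (2 ^ k) (p ^ ℓ) p
    where
    regroup : ∀ a b p → a * b * 2 * p ≡ 2 * a * (p * b)
    regroup = solve-∀

  2∣r : 2 ∣ r
  2∣r with 2∣n⊎2∣1+n r
  ... | inj₁ even = even
  ... | inj₂ even = contradiction even p-odd

  -- The exponent q p is n/2, so this power squares to 1 without being 1.
  z^qp≈-1 : ∀ {z} → IsPrimitiveRoot n z → z ^ᵒ (q * p) ≈ᶜ -1ᶜ
  z^qp≈-1 {z} prim = Co.u²≈1⇒u≈-1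
    (ℂ′.trans (^-assocʳ z (q * p) 2) (ℂ′.trans (^-congʳ z [qp]2≡n) (primitive-pow≈1 prim)))
    (primitive-pow≉1 prim (q * p) (subst (q * p <_) [qp]2≡n (ℕ.m<m*n (q * p) 2 (s≤s z<s))))

  θᵖ≈1 : ∀ {z} → IsPrimitiveRoot n z → (-1ᶜ ⊠ z ^ᵒ q) ^ᵒ p ≈ᶜ 1ᶜ
  θᵖ≈1 {z} prim = begin
    (-1ᶜ ⊠ z ^ᵒ q) ^ᵒ p           ≈⟨ ^-distrib-* -1ᶜ (z ^ᵒ q) p ⟩
    -1ᶜ ^ᵒ p ⊠ (z ^ᵒ q) ^ᵒ p      ≈⟨ ℂ′.*-cong (Co.odd-power Co.-1*-1≈1 2∣r) (ℂ′.trans (^-assocʳ z q p) (z^qp≈-1 prim)) ⟩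
    -1ᶜ ⊠ -1ᶜ                     ≈⟨ Co.-1*-1≈1 ⟩
    1ᶜ                            ∎

  -- Squaring removes the sign: -z^q = 1 would give z^(2q) = 1, although 2 q = n/p is below the
  -- order of z.
  θ≉1 : ∀ {z} → IsPrimitiveRoot n z → ¬ (-1ᶜ ⊠ z ^ᵒ q ≈ᶜ 1ᶜ)
  θ≉1 {z} prim θ≈1 = primitive-pow≉1 prim (q * 2)
    (subst (q * 2 <_) [q2]p≡n (ℕ.m<m*n (q * 2) p 1<p)) (begin
      z ^ᵒ (q * 2)                       ≈⟨ ^-assocʳ z q 2 ⟨
      (z ^ᵒ q) ^ᵒ 2                      ≈⟨ ℂ′.*-identityˡ ((z ^ᵒ q) ^ᵒ 2) ⟨
      1ᶜ ⊠ (z ^ᵒ q) ^ᵒ 2                 ≈⟨ ℂ′.*-congʳ (ℂ′.trans (ℂ′.*-congˡ (ℂ′.*-identityʳ -1ᶜ)) Co.-1*-1≈1) ⟨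
      -1ᶜ ^ᵒ 2 ⊠ (z ^ᵒ q) ^ᵒ 2           ≈⟨ ^-distrib-* -1ᶜ (z ^ᵒ q) 2 ⟨
      (-1ᶜ ⊠ z ^ᵒ q) ^ᵒ 2                ≈⟨ ^-congˡ 2 θ≈1 ⟩
      1ᶜ ^ᵒ 2                            ≈⟨ Co.1^n≈1 2 ⟩
      1ᶜ                                 ∎)
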